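{- Let $H_d$ denote the $d$-dimensional hypercube graph. Then $\mathrm{cub}(H_d) = \Theta\left(\frac{d}{\log d}\right)$ as $d \to \infty$; that is, there exist constants $c_1, c_2 > 0$ and an integer $d_0 \ge 2$ such that for all integers $d \ge d_0$, $c_1 \frac{d}{\log d} \le \mathrm{cub}(H_d) \le c_2 \frac{d}{\log d}$.
   Context: The $d$-dimensional hypercube $H_d$ is the graph whose vertices correspond to the $2^d$ binary strings of length $d$, two vertices being adjacent if and only if the corresponding strings differ in exactly one bit position. A $k$-dimensional (axis-parallel) cube is a Cartesian product $R_1 \times R_2 \times \cdots \times R_k$ where each $R_i$ is a closed interval of the form $[a_i, a_i+1]$ on the real line. A finite simple graph $G$ is representable as the intersection graph of a family of sets $(S_x)_{x \in V(G)}$ if two distinct vertices $x,y$ are adjacent in $G$ if and only if $S_x \cap S_y \neq \emptyset$. The cubicity $\mathrm{cub}(G)$ is the minimum $k$ such that $G$ is representable as the intersection graph of axis-parallel cubes in $k$-dimensional space. -}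

module Defs where

open import Data.Bool.Base using (Bool)
open import Data.Empty using (⊥-elim)
open import Data.Fin.Base using (Fin)
open import Data.Fin.Properties using (1↔⊤; 2↔Bool; *↔×)
open import Data.Integer.Base as ℤ using (+_; -[1+_])
import Data.Integer.Properties as ℤₚ
open import Data.Nat.Base as ℕ using (ℕ; zero; suc; z≤n; s≤s; _^_)
import Data.Nat.Properties as ℕₚ
open import Data.Product using (Σ-syntax; ∃; ∃₂; ∃!; ∃-syntax; _×_; _,_)
open import Data.Product.Function.NonDependent.Propositional using (_×-↔_)
open import Data.Rational
  using (ℚ; mkℚ; _<_; _+_; _-_; _*_; -_; _/_; 1/_; 0ℚ; 1ℚ; Positive; positive; *<*)
open import Data.Rational.Properties
  using ( <-dense; <-trans; <-cmp; <-asym; <-respˡ-≡; <-respʳ-≡; +-monoˡ-<; +-monoʳ-<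
        ; +-identityʳ; +-assoc; +-inverseˡ; +-inverseʳ
        ; *-assoc; *-comm; *-identityˡ; *-identityʳ; *-inverseˡ; *-inverseʳ
        ; *-monoʳ-<-pos; positive⁻¹; pos⇒nonZero; 1/pos⇒pos
        ; normalize-pos; ↥p/↧p≡p; toℚᵘ-mono-<; toℚᵘ-fromℚᵘ)
open import Data.Rational.Unnormalised.Base using (mkℚᵘ)
import Data.Rational.Unnormalised.Properties as ℚᵘₚ
open import Data.Sum.Base using (_⊎_; inj₁; inj₂)
open import Data.Unit.Base using (tt)
open import Data.Vec.Base using (Vec; []; _∷_; head; tail; lookup)
open import Data.Vec.Functional using (Vector)
open import Function.Base using (_∘_)
open import Function.Bundles using (_↔_; _⇔_; mk↔ₛ′)
open import Function.Construct.Composition using (_↔-∘_)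
open import Function.Construct.Symmetry using (↔-sym)
open import Level using (0ℓ; _⊔_)
open import Relation.Binary.Core using (Rel)
open import Relation.Binary.Definitions using (Irreflexive; Symmetric; tri<; tri≈; tri>)
open import Relation.Binary.PropositionalEquality
open import Relation.Unary using (Pred; _∈_; _∉_; _⊆_; _≬_)

private
  p-1<p : ∀ p → p - 1ℚ < p
  p-1<p p = <-respʳ-≡ (+-identityʳ p) (+-monoʳ-< p {x = - 1ℚ} {y = 0ℚ} (*<* ℤ.-<+))

  p<p+1 : ∀ p → p < p + 1ℚ
  p<p+1 p = <-respˡ-≡ (+-identityʳ p) (+-monoʳ-< p {x = 0ℚ} {y = 1ℚ} (*<* (ℤ.+<+ (s≤s z≤n))))

  p+1-1≡p : ∀ p → p + 1ℚ - 1ℚ ≡ p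
  p+1-1≡p p = trans (+-assoc p 1ℚ (- 1ℚ)) (trans (cong (λ z → p + z) (+-inverseʳ 1ℚ)) (+-identityʳ p))

  p-1+1≡p : ∀ p → p - 1ℚ + 1ℚ ≡ p
  p-1+1≡p p = trans (+-assoc p (- 1ℚ) 1ℚ) (trans (cong (λ z → p + z) (+-inverseˡ 1ℚ)) (+-identityʳ p))

-- Two-sided located Dedekind cuts of ℚ.
record ℝ : Set₁ where
  field
    lower upper     : Pred ℚ 0ℓ
    lower-inhabited : ∃ lower
    upper-inhabited : ∃ upper
    lower-closed    : ∀ {p q} → p < q → q ∈ lower → p ∈ lower
    upper-closed    : ∀ {p q} → p < q → p ∈ upper → q ∈ upper
    lower-open      : ∀ {p} → p ∈ lower → ∃[ q ] p < q × q ∈ lower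
    upper-open      : ∀ {q} → q ∈ upper → ∃[ p ] p < q × p ∈ upper
    disjoint        : ∀ {q} → q ∈ lower → q ∉ upper
    located         : ∀ {p q} → p < q → p ∈ lower ⊎ q ∈ upper

  lower<upper : ∀ {p q} → p ∈ lower → q ∈ upper → p < q
  lower<upper {p} {q} p∈L q∈U with <-cmp p q
  ... | tri< p<q _ _    = p<q
  ... | tri≈ _ refl _   = ⊥-elim (disjoint p∈L q∈U)
  ... | tri> _ _ q<p    = ⊥-elim (disjoint p∈L (upper-closed q<p q∈U))

open ℝ

infix 4 _≤ᴿ_

_≤ᴿ_ : Rel ℝ 0ℓ
x ≤ᴿ y = lower x ⊆ lower y

fromℚ : ℚ → ℝ
fromℚ a = record
  { lower           = _< a
  ; upper           = a <_
  ; lower-inhabited = a - 1ℚ , p-1<p a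
  ; upper-inhabited = a + 1ℚ , p<p+1 a
  ; lower-closed    = <-trans
  ; upper-closed    = λ p<q a<p → <-trans a<p p<q
  ; lower-open      = <-dense
  ; upper-open      = λ a<q → let (p , a<p , p<q) = <-dense a<q in p , p<q , a<p
  ; disjoint        = <-asym
  ; located         = loc
  }
  where
  loc : ∀ {p q} → p < q → p < a ⊎ a < q
  loc {p} p<q with <-cmp p a
  ... | tri< p<a _ _  = inj₁ p<a
  ... | tri≈ _ refl _ = inj₂ p<q
  ... | tri> _ _ a<p  = inj₂ (<-trans a<p p<q)

fromℕ : ℕ → ℝ
fromℕ n = fromℚ (+ n / 1)

infixl 6 _+1

_+1 : ℝ → ℝ
x +1 = record
  { lower           = λ q → q - 1ℚ ∈ lower x
  ; upper           = λ q → q - 1ℚ ∈ upper x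
  ; lower-inhabited = let (q , q∈L) = lower-inhabited x
                      in q + 1ℚ , subst (lower x) (sym (p+1-1≡p q)) q∈L
  ; upper-inhabited = let (q , q∈U) = upper-inhabited x
                      in q + 1ℚ , subst (upper x) (sym (p+1-1≡p q)) q∈U
  ; lower-closed    = λ p<q → lower-closed x (+-monoˡ-< (- 1ℚ) p<q)
  ; upper-closed    = λ p<q → upper-closed x (+-monoˡ-< (- 1ℚ) p<q)
  ; lower-open      = λ {p} p∈L → let (q , p<q , q∈L) = lower-open x p∈L
                      in q + 1ℚ , <-respˡ-≡ (p-1+1≡p p) (+-monoˡ-< 1ℚ p<q)
                       , subst (lower x) (sym (p+1-1≡p q)) q∈L
  ; upper-open      = λ {q} q∈U → let (p , p<q , p∈U) = upper-open x q∈U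
                      in p + 1ℚ , <-respʳ-≡ (p-1+1≡p q) (+-monoˡ-< 1ℚ p<q)
                       , subst (upper x) (sym (p+1-1≡p p)) p∈U
  ; disjoint        = disjoint x
  ; located         = λ p<q → located x (+-monoˡ-< (- 1ℚ) p<q)
  }

-- The inverse is only ever taken of positive rationals, so a proof of
-- positivity is passed around instead of a NonZero instance.
inv : (q : ℚ) → Positive q → ℚ
inv q q>0 = (1/ q) {{pos⇒nonZero q {{q>0}}}}

private
  inv-pos : ∀ q (q>0 : Positive q) → Positive (inv q q>0)
  inv-pos q q>0 = 1/pos⇒pos q {{q>0}}

  inv-invˡ : ∀ q (q>0 : Positive q) → inv q q>0 * q ≡ 1ℚ
  inv-invˡ q q>0 = *-inverseˡ q {{pos⇒nonZero q {{q>0}}}}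

  inv-invʳ : ∀ q (q>0 : Positive q) → q * inv q q>0 ≡ 1ℚ
  inv-invʳ q q>0 = *-inverseʳ q {{pos⇒nonZero q {{q>0}}}}

  inv-involutive : ∀ q (q>0 : Positive q) → inv (inv q q>0) (inv-pos q q>0) ≡ q
  inv-involutive (mkℚ (+ suc _) _ _) _ = refl

  inv-anti : ∀ {p q} (p>0 : Positive p) (q>0 : Positive q) → p < q → inv q q>0 < inv p p>0
  inv-anti {p} {q} p>0 q>0 p<q = subst₂ _<_ eq₁ eq₂ (*-monoʳ-<-pos i⁻¹ {{pos₁}} (*-monoʳ-<-pos j⁻¹ {{pos₂}} p<q))
    where
    i⁻¹ = inv p p>0
    j⁻¹ = inv q q>0
    pos₁ = inv-pos p p>0
    pos₂ = inv-pos q q>0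
    eq₁ : i⁻¹ * (j⁻¹ * p) ≡ j⁻¹
    eq₁ = trans (cong (i⁻¹ *_) (*-comm j⁻¹ p))
         (trans (sym (*-assoc i⁻¹ p j⁻¹))
         (trans (cong (_* j⁻¹) (inv-invˡ p p>0)) (*-identityˡ j⁻¹)))
    eq₂ : i⁻¹ * (j⁻¹ * q) ≡ i⁻¹
    eq₂ = trans (cong (i⁻¹ *_) (inv-invˡ q q>0)) (*-identityʳ i⁻¹)

  inv-*-cancel : ∀ c (c>0 : Positive c) q → inv c c>0 * (c * q) ≡ q
  inv-*-cancel c c>0 q = trans (sym (*-assoc (inv c c>0) c q))
                        (trans (cong (_* q) (inv-invˡ c c>0)) (*-identityˡ q))

  *-inv-cancel : ∀ c (c>0 : Positive c) q → c * (inv c c>0 * q) ≡ q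
  *-inv-cancel c c>0 q = trans (sym (*-assoc c (inv c c>0) q))
                        (trans (cong (_* q) (inv-invʳ c c>0)) (*-identityˡ q))

scale : (c : ℚ) → Positive c → ℝ → ℝ
scale c c>0 x = record
  { lower           = λ q → c⁻¹ * q ∈ lower x
  ; upper           = λ q → c⁻¹ * q ∈ upper x
  ; lower-inhabited = let (q , q∈L) = lower-inhabited x
                      in c * q , subst (lower x) (sym (inv-*-cancel c c>0 q)) q∈L
  ; upper-inhabited = let (q , q∈U) = upper-inhabited x
                      in c * q , subst (upper x) (sym (inv-*-cancel c c>0 q)) q∈U
  ; lower-closed    = λ p<q → lower-closed x (shrink p<q)
  ; upper-closed    = λ p<q → upper-closed x (shrink p<q)
  ; lower-open      = λ {p} p∈L → let (q , p<q , q∈L) = lower-open x p∈L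
                      in c * q , <-respˡ-≡ (*-inv-cancel c c>0 p) (*-monoʳ-<-pos c {{c>0}} p<q)
                       , subst (lower x) (sym (inv-*-cancel c c>0 q)) q∈L
  ; upper-open      = λ {q} q∈U → let (p , p<q , p∈U) = upper-open x q∈U
                      in c * p , <-respʳ-≡ (*-inv-cancel c c>0 q) (*-monoʳ-<-pos c {{c>0}} p<q)
                       , subst (upper x) (sym (inv-*-cancel c c>0 p)) p∈U
  ; disjoint        = disjoint x
  ; located         = λ p<q → located x (shrink p<q)
  }
  where
  c⁻¹ = inv c c>0
  shrink : ∀ {p q} → p < q → c⁻¹ * p < c⁻¹ * q
  shrink = *-monoʳ-<-pos c⁻¹ {{inv-pos c c>0}}

Positiveᴿ : ℝ → Set
Positiveᴿ x = 0ℚ ∈ lower x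

recip : (x : ℝ) → Positiveᴿ x → ℝ
recip x x>0 = record
  { lower           = L
  ; upper           = U
  ; lower-inhabited = let (s , s∈U) = upper-inhabited x
                          s>0 = upper-pos s∈U
                      in inv s s>0 - 1ℚ , s , s>0 , s∈U , p-1<p _
  ; upper-inhabited = let (s , 0<s , s∈L) = lower-open x x>0
                          s>0 = positive 0<s
                      in inv s s>0 + 1ℚ , s , s>0 , s∈L , p<p+1 _
  ; lower-closed    = λ p<q (s , s>0 , s∈U , q<1/s) → s , s>0 , s∈U , <-trans p<q q<1/s
  ; upper-closed    = λ p<q (s , s>0 , s∈L , 1/s<p) → s , s>0 , s∈L , <-trans 1/s<p p<q
  ; lower-open      = λ (s , s>0 , s∈U , p<1/s) → let (q , p<q , q<1/s) = <-dense p<1/s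
                      in q , p<q , s , s>0 , s∈U , q<1/s
  ; upper-open      = λ (s , s>0 , s∈L , 1/s<q) → let (p , 1/s<p , p<q) = <-dense 1/s<q
                      in p , p<q , s , s>0 , s∈L , 1/s<p
  ; disjoint        = λ (s , s>0 , s∈U , q<1/s) (t , t>0 , t∈L , 1/t<q) →
                      <-asym (<-trans 1/t<q q<1/s) (inv-anti t>0 s>0 (lower<upper x t∈L s∈U))
  ; located         = loc
  }
  where
  L U : Pred ℚ 0ℓ
  L q = ∃[ s ] Σ[ s>0 ∈ Positive s ] s ∈ upper x × q < inv s s>0
  U q = ∃[ s ] Σ[ s>0 ∈ Positive s ] s ∈ lower x × inv s s>0 < q

  upper-pos : ∀ {s} → s ∈ upper x → Positive s
  upper-pos s∈U = positive (lower<upper x x>0 s∈U)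

  loc : ∀ {p q} → p < q → L p ⊎ U q
  loc {p} {q} p<q with <-dense p<q
  ... | m , p<m , m<q with <-cmp 0ℚ m
  ...   | tri> _ _ m<0 = let (s , s∈U) = upper-inhabited x
                             s>0 = upper-pos s∈U
                         in inj₁ (s , s>0 , s∈U , <-trans (<-trans p<m m<0)
                                                  (positive⁻¹ _ {{inv-pos s s>0}}))
  ...   | tri≈ _ refl _ = let (s , s∈U) = upper-inhabited x
                              s>0 = upper-pos s∈U
                          in inj₁ (s , s>0 , s∈U , <-trans p<m (positive⁻¹ _ {{inv-pos s s>0}}))
  ...   | tri< 0<m _ _ with <-dense m<q
  ...     | n , m<n , n<q with positive 0<m | positive (<-trans 0<m m<n)
  ...       | m>0 | n>0 with located x (inv-anti m>0 n>0 m<n)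
  ...         | inj₁ 1/n∈L = inj₂ (inv n n>0 , inv-pos n n>0 , 1/n∈L
                                  , <-respˡ-≡ (sym (inv-involutive n n>0)) n<q)
  ...         | inj₂ 1/m∈U = inj₁ (inv m m>0 , inv-pos m m>0 , 1/m∈U
                                  , <-respʳ-≡ (sym (inv-involutive m m>0)) p<m)

private
  cross : ∀ p q p′ q′ → + p / suc q < + p′ / suc q′ → p ℕ.* suc q′ ℕ.< p′ ℕ.* suc q
  cross p q p′ q′ lt = ℤₚ.drop‿+<+ (subst₂ ℤ._<_ (sym (ℤₚ.pos-* p (suc q′))) (sym (ℤₚ.pos-* p′ (suc q)))
    (ℚᵘₚ.drop-*<* (ℚᵘₚ.<-respˡ-≃ (toℚᵘ-fromℚᵘ (mkℚᵘ (+ p) q))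
                  (ℚᵘₚ.<-respʳ-≃ (toℚᵘ-fromℚᵘ (mkℚᵘ (+ p′) q′)) (toℚᵘ-mono-< lt)))))

  ^-swap : ∀ m a b → (m ^ a) ^ b ≡ (m ^ b) ^ a
  ^-swap m a b = trans (ℕₚ.^-*-assoc m a b)
                (trans (cong (m ^_) (ℕₚ.*-comm a b)) (sym (ℕₚ.^-*-assoc m b a)))

  n≤2^n : ∀ n → n ℕ.≤ 2 ^ n
  n≤2^n zero    = z≤n
  n≤2^n (suc n) = ℕₚ.≤-trans (ℕₚ.+-mono-≤ (ℕₚ.m^n>0 2 n) (n≤2^n n))
                             (ℕₚ.≤-reflexive (cong (λ z → 2 ^ n ℕ.+ z) (sym (ℕₚ.+-identityʳ (2 ^ n)))))

-- For natural p and q > 0,  p / q ≤ log₂ n  iff  2 ^ p ≤ n ^ q, so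
-- log₂ n is the supremum of the fractions p / q with 2 ^ p ≤ n ^ q and the
-- infimum of those with n ^ q ≤ 2 ^ p.
log₂ : (n : ℕ) .{{_ : ℕ.NonZero n}} → ℝ
log₂ n = record
  { lower           = L
  ; upper           = U
  ; lower-inhabited = + 0 / 1 - 1ℚ , 0 , 0 , p-1<p _ , 1≤n^1
  ; upper-inhabited = + n / 1 + 1ℚ , n , 0 , p<p+1 _ , n^1≤2^n
  ; lower-closed    = λ r<r′ (p , q , r′< , le) → p , q , <-trans r<r′ r′< , le
  ; upper-closed    = λ r<r′ (p , q , <r , le) → p , q , <-trans <r r<r′ , le
  ; lower-open      = λ (p , q , r< , le) → let (s , r<s , s<) = <-dense r<
                      in s , r<s , p , q , s< , le
  ; upper-open      = λ (p , q , <r , le) → let (s , <s , s<r) = <-dense <r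
                      in s , s<r , p , q , <s , le
  ; disjoint        = λ (p , q , r< , le) (p′ , q′ , <r , le′) →
                      ℕₚ.<⇒≱ (ℕₚ.^-monoʳ-< 2 (s≤s (s≤s z≤n)) (cross p′ q′ p q (<-trans <r r<)))
                      (subst₂ ℕ._≤_ (ℕₚ.^-*-assoc 2 p (suc q′)) (ℕₚ.^-*-assoc 2 p′ (suc q))
                        (ℕₚ.≤-trans (ℕₚ.^-monoˡ-≤ (suc q′) le)
                        (ℕₚ.≤-trans (ℕₚ.≤-reflexive (^-swap n (suc q) (suc q′)))
                                    (ℕₚ.^-monoˡ-≤ (suc q) le′))))
  ; located         = loc
  }
  where
  L U : Pred ℚ 0ℓ
  L r = ∃₂ λ p q → r < + p / suc q × 2 ^ p ℕ.≤ n ^ suc q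
  U r = ∃₂ λ p q → + p / suc q < r × n ^ suc q ℕ.≤ 2 ^ p

  1≤n^1 : 1 ℕ.≤ n ^ 1
  1≤n^1 = ℕₚ.m^n>0 n 1

  n^1≤2^n : n ^ 1 ℕ.≤ 2 ^ n
  n^1≤2^n = ℕₚ.≤-trans (ℕₚ.≤-reflexive (ℕₚ.*-identityʳ n)) (n≤2^n n)

  loc : ∀ {r r′} → r < r′ → L r ⊎ U r′
  loc r<r′ with <-dense r<r′
  ... | mkℚ -[1+ _ ] _ _ , r<s , _ = inj₁ (0 , 0 , <-trans r<s (*<* ℤ.-<+) , 1≤n^1)
  ... | s@(mkℚ (+ p) q _) , r<s , s<r′ with ℕₚ.≤-total (2 ^ p) (n ^ suc q)
  ...   | inj₁ le = inj₁ (p , q , <-respʳ-≡ (sym (↥p/↧p≡p s)) r<s , le)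
  ...   | inj₂ ge = inj₂ (p , q , <-respˡ-≡ (sym (↥p/↧p≡p s)) s<r′ , ge)

log₂-positive : ∀ n .{{_ : ℕ.NonZero n}} → 2 ℕ.≤ n → Positiveᴿ (log₂ n)
log₂-positive n 2≤n = 1 , 0 , *<* (ℤ.+<+ (s≤s z≤n)) , ℕₚ.^-monoˡ-≤ 1 2≤n

m/log₂m : (m : ℕ) → 2 ℕ.≤ m → ℝ
m/log₂m m@(suc _) 2≤m = scale (+ m / 1) (normalize-pos m 1) (recip (log₂ m) (log₂-positive m 2≤m))

record Graph : Set₁ where
  field
    Vertex      : Set
    Adj         : Rel Vertex 0ℓ
    finite      : ∃[ n ] Vertex ↔ Fin n
    irreflexive : Irreflexive _≡_ Adj
    symmetric   : Symmetric Adj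

open Graph public

H : ℕ → Graph
H d = record
  { Vertex      = Vec Bool d
  ; Adj         = λ x y → ∃! _≡_ λ i → lookup x i ≢ lookup y i
  ; finite      = 2 ^ d , ↔-sym (Fin↔Vec d)
  ; irreflexive = λ { refl (_ , x≢x , _) → x≢x refl }
  ; symmetric   = λ (i , x≢y , uniq) → i , x≢y ∘ sym , λ y≢x → uniq (y≢x ∘ sym)
  }
  where
  Fin↔Vec : ∀ n → Fin (2 ^ n) ↔ Vec Bool n
  Fin↔Vec zero    = mk↔ₛ′ (λ _ → []) (λ _ → tt) (λ { [] → refl }) (λ _ → refl) ↔-∘ 1↔⊤
  Fin↔Vec (suc n) = cons↔ ↔-∘ ((2↔Bool ×-↔ Fin↔Vec n) ↔-∘ *↔×)
    where
    cons↔ : (Bool × Vec Bool n) ↔ Vec Bool (suc n)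
    cons↔ = mk↔ₛ′ (λ (b , v) → b ∷ v) (λ v → head v , tail v) (λ { (_ ∷ _) → refl }) (λ _ → refl)

-- The cube [a₁ , a₁ + 1] × ⋯ × [aₖ , aₖ + 1].
cube : ∀ {k} → Vector ℝ k → Pred (Vector ℝ k) 0ℓ
cube a p = ∀ i → a i ≤ᴿ p i × p i ≤ᴿ a i +1

IsIntersectionGraph : ∀ {a ℓ} {A : Set a} (G : Graph) → (Vertex G → Pred A ℓ) → Set (a ⊔ ℓ)
IsIntersectionGraph G S = ∀ x y → x ≢ y → Adj G x y ⇔ S x ≬ S y

CubeRepresentable : Graph → ℕ → Set₁
CubeRepresentable G k = Σ[ a ∈ (Vertex G → Vector ℝ k) ] IsIntersectionGraph G (cube ∘ a)

IsCubicity : Graph → ℕ → Set₁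
IsCubicity G k = CubeRepresentable G k × (∀ j → CubeRepresentable G j → k ℕ.≤ j)

{-# OPTIONS --safe #-}
module Submission where

-- Lower bound.  In each of the k coordinates the cubes of H d have offsets in
-- an interval of length 2d, since H d has diameter d.  Cutting it into unit
-- intervals gives (2d)ᵏ cells, and vertices in a common cell are adjacent, so
-- the 2ᵈ⁻¹ words of even weight lie in different cells.
--
-- Upper bound.  Represent x by the values of linear forms w with coefficients
-- in {-1, 0, 1}, which differ by at most 1 on adjacent words; it remains to
-- find O(d / log d) forms such that every z = x - y with at least two nonzero
-- entries has |w(z)| ≥ 2 for some w.  A coin-weighing matrix with O(n / log n)
-- rows, restricted to a block of n coordinates and with entries made ±1, shows
-- that z is zero on the block or has nonzero sum there; sums and differences
-- of block sums then exclude two nonzero blocks.  With the coordinates in an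
-- r × r × r grid, the slices along the three axes as blocks leave one point.
--
-- Constructively, the minimum in the definition of cubicity exists because k
-- cubes per vertex can be replaced by the ranks of their offsets and the
-- relation "offset of v ≤ offset of u + 1", which are finite data: real
-- offsets yield them up to double negation, they can be searched for, and
-- they are always realized by rational offsets.

open import Defs
open import Data.Bool.Base using (Bool; true; false; not; _∧_; _xor_)
import Data.Bool.Properties as Boolₚ
open import Data.Empty using (⊥-elim)
open import Data.Fin.Base as Fin
  using (Fin; zero; suc; toℕ; fromℕ<; funToFin; finToFun; inject≤; combine; remQuot)
open import Data.Fin.Patterns using (0F; 1F; 2F)
open import Data.Fin.Properties as Finₚ
  using ( any?; all?; toℕ-fromℕ<; toℕ<n; sequence; pigeonhole; finToFun-funToFin; 1↔⊤; 2↔Bool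
        ; *↔×; +↔⊎; inject≤-injective; combine-remQuot; combine-injective)
open import Data.Fin.Subset using (Subset; inside; _⊂_)
open import Data.Fin.Subset.Properties using (p⊂q⇒∣p∣<∣q∣; ∣p∣≤n)
open import Data.Integer.Base as ℤ using (ℤ; +_; -[1+_]; 0ℤ; 1ℤ; -1ℤ; ∣_∣)
import Data.Integer.Properties as ℤₚ
open import Data.Integer.Solver using (module +-*-Solver)
open import Data.List.Base using (List; []; _∷_; map; filter; _++_; allFin)
open import Data.List.Membership.Propositional renaming (_∈_ to _∈ₗ_)
open import Data.List.Membership.Propositional.Properties
  using (∈-map⁺; ∈-map⁻; ∈-filter⁺; ∈-filter⁻; ∈-allFin; ∈-++⁺ˡ; ∈-++⁺ʳ; ∈-++⁻)
open import Data.List.Relation.Unary.All as All using (All; []; _∷_)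
open import Data.List.Relation.Unary.Any using (here; there)
open import Data.Maybe.Base using (Maybe; just; nothing; maybe)
open import Data.Nat.Base as ℕ using (ℕ; zero; suc; s≤s; z≤n; _^_; _≤_)
import Data.Nat.Properties as ℕₚ
open import Data.Nat.Properties using (≤-trans)
import Data.Nat.Solver as ℕSolver
open import Data.Product using (Σ-syntax; ∃; ∃-syntax; _×_; _,_; proj₁; proj₂)
open import Data.Product.Function.NonDependent.Propositional using (_×-↔_)
open import Data.Rational as ℚ
  using (ℚ; 0ℚ; 1ℚ; Positive; -_; _+_; _-_; _*_; _/_; _<_; *<*; toℚᵘ)
open import Data.Rational.Properties as ℚₚ
  using ( <-dense; <-trans; <⇒≤; ≮⇒≥; _<?_; <-≤-trans; <-irrefl; <-respʳ-≡; <-respˡ-≡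
        ; +-monoˡ-<; +-monoʳ-<; +-identityʳ; +-assoc; +-inverseˡ; +-inverseʳ)
open import Data.Rational.Unnormalised.Base as ℚᵘ using (mkℚᵘ; *≤*; *≡*)
import Data.Rational.Unnormalised.Properties as ℚᵘₚ
open import Data.Sum.Base using (_⊎_; inj₁; inj₂; [_,_]′)
open import Data.Sum.Function.Propositional using (_⊎-↔_)
open import Data.Unit.Base using (tt)
open import Data.Vec.Base as Vec using (Vec; []; _∷_; lookup; tabulate)
open import Data.Vec.Functional using (Vector)
open import Data.Vec.Properties
  using (lookup∘tabulate; tabulate∘lookup; tabulate-cong; []=⇒lookup; lookup⇒[]=; ∷-injectiveʳ; ≡-dec)
open import Effect.Monad using (RawMonad)
open import Function.Base using (_∘_; _$_; id; const)
open import Function.Bundles using (_⇔_; mk⇔; Equivalence; Inverse; _↔_; mk↔ₛ′)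
open import Function.Construct.Composition using (_↔-∘_)
open import Function.Construct.Identity using (↔-id)
open import Function.Construct.Symmetry using (↔-sym)
open import Relation.Binary.PropositionalEquality
open import Relation.Nullary using (¬_; Dec; yes; no; does; contradiction)
open import Relation.Nullary.Decidable as Dec
  using (_×-dec_; _→-dec_; ¬?; ¬¬-excluded-middle; decidable-stable; map′)
open import Relation.Nullary.Negation using (¬¬-Monad; ¬¬-map)
open import Relation.Unary using (Decidable)

open import Algebra.Properties.Semiring.Sum ℤₚ.+-*-semiring
  using (sum; sum-cong-≗; ∑-distrib-+; *-distribˡ-sum; sum-replicate-zero)

-- Order data of points on a line

-- Decides existence by exhaustive search. Closure under products and vectors reduces the search for
-- a whole family of layouts to searches over `Bool` and `Fin`.
Searchable : Set → Set₁
Searchable A = {P : A → Set} → Decidable P → Dec (∃ P)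

searchBool : Searchable Bool
searchBool P? with P? true | P? false
... | yes p | _     = yes (true , p)
... | no _  | yes p = yes (false , p)
... | no ¬t | no ¬f = no λ { (true , p) → ¬t p ; (false , p) → ¬f p }

search-× : ∀ {A B} → Searchable A → Searchable B → Searchable (A × B)
search-× sA sB P? = map′ (λ (a , b , p) → (a , b) , p) (λ ((a , b) , p) → a , b , p)
  (sA λ a → sB λ b → P? (a , b))

searchVec : ∀ {A} n → Searchable A → Searchable (Vec A n)
searchVec zero    sA P? = map′ (λ p → [] , p) (λ { ([] , p) → p }) (P? [])
searchVec (suc n) sA P? = map′ (λ (a , v , p) → a ∷ v , p) (λ { (a ∷ v , p) → a , v , p })
  (sA λ a → searchVec n sA λ v → P? (a ∷ v))

p<p+1 : ∀ p → p < p + 1ℚ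
p<p+1 p = <-respˡ-≡ (+-identityʳ p) (+-monoʳ-< p {x = 0ℚ} {y = 1ℚ} (*<* (ℤ.+<+ (s≤s z≤n))))

p-1<p : ∀ p → p - 1ℚ < p
p-1<p p = <-respʳ-≡ (+-identityʳ p) (+-monoʳ-< p {x = - 1ℚ} {y = 0ℚ} (*<* ℤ.-<+))

below : (us : List ℚ) → ∃[ z ] All (z <_) us
below []       = 0ℚ , []
below (u ∷ us) with below us
... | z , z<us with z <? u
...   | yes z<u = z , z<u ∷ z<us
...   | no  z≮u = u - 1ℚ , p-1<p u ∷ All.map (<-trans (<-≤-trans (p-1<p u) (≮⇒≥ z≮u))) z<us

between₁ : ∀ l us → All (l <_) us → ∃[ z ] l < z × All (z <_) us
between₁ l []       []           = l + 1ℚ , p<p+1 l , []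
between₁ l (u ∷ us) (l<u ∷ l<us) with between₁ l us l<us
... | z , l<z , z<us with z <? u
...   | yes z<u = z , l<z , z<u ∷ z<us
...   | no  z≮u = let (y , l<y , y<u) = <-dense l<u
                  in y , l<y , y<u ∷ All.map (<-trans (<-≤-trans y<u (≮⇒≥ z≮u))) z<us

-- The rationals are dense without endpoints, so finitely many strict lower bounds below finitely
-- many strict upper bounds leave a gap. The chosen point is pushed up past each lower bound that it
-- does not yet exceed.
between : ∀ ls us → (∀ {l u} → l ∈ₗ ls → u ∈ₗ us → l < u) →
          ∃[ z ] All (_< z) ls × All (z <_) us
between []       us _     = let (z , z<us) = below us in z , [] , z<us
between (l ∷ ls) us ls<us with between ls us (ls<us ∘ there)
... | z , ls<z , z<us with l <? z
...   | yes l<z = z , l<z ∷ ls<z , z<us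
...   | no  l≮z = let (y , l<y , y<us) = between₁ l us (All.tabulate (ls<us (here refl)))
                  in y , l<y ∷ All.map (λ x<z → <-trans (<-≤-trans x<z (≮⇒≥ l≮z)) l<y) ls<z , y<us

-- The order data of a map x from Fin n to the line: π ranks the points and
-- E u v stands for x v ≤ x u + 1.
record IsSemiorder {n} (π : Fin n → ℕ) (E : Fin n → Fin n → Set) : Set where
  field
    downward : ∀ {u v} → π v ℕ.≤ π u → E u v
    monotone : ∀ {u v u′ v′} → π u ℕ.≤ π u′ → π v′ ℕ.≤ π v → E u v → E u′ v′

-- Points are placed in order of rank, all points of one rank at the same place. Every constraint is
-- kept strict, even where `E` only asks for `≤`, so that density leaves room for the next point.
module Realize {n} (π : Fin n → ℕ) (E : Fin n → Fin n → Set) (E? : ∀ u v → Dec (E u v))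
               (semi : IsSemiorder π E) where
  open IsSemiorder semi

  record RealizedBelow (r : ℕ) (x : Fin n → ℚ) : Set where
    field
      increasing : ∀ {u v} → π u ℕ.< r → π v ℕ.< r → π u ℕ.< π v → x u < x v
      near       : ∀ {u v} → π u ℕ.< r → π v ℕ.< r → E u v → x v < x u + 1ℚ
      far        : ∀ {u v} → π u ℕ.< r → π v ℕ.< r → ¬ E u v → x u + 1ℚ < x v

  open RealizedBelow

  private
    <-suc : ∀ {a r} → a ℕ.< suc r → a ≢ r → a ℕ.< r
    <-suc (s≤s a≤r) a≢r = ℕₚ.≤∧≢⇒< a≤r a≢r

  module Step (r : ℕ) (x : Fin n → ℚ) (ok : RealizedBelow r x) (w : Fin n) (πw : π w ≡ r) where

    earlier near-w far-w : List (Fin n)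
    earlier = filter (λ u → π u ℕₚ.<? r) (allFin n)
    near-w  = filter (λ u → E? u w) earlier
    far-w   = filter (λ u → ¬? (E? u w)) earlier

    ∈-earlier : ∀ {u} → π u ℕ.< r → u ∈ₗ earlier
    ∈-earlier {u} = ∈-filter⁺ _ (∈-allFin u)

    earlier-< : ∀ {u} → u ∈ₗ earlier → π u ℕ.< r
    earlier-< u∈ = proj₂ (∈-filter⁻ (λ u → π u ℕₚ.<? r) {xs = allFin n} u∈)

    lowers uppers : List ℚ
    lowers = map x earlier ++ map (λ u → x u + 1ℚ) far-w
    uppers = map (λ u → x u + 1ℚ) near-w

    -- If `b` is near `w`, it is near every earlier `a`, since `a` ranks below `w`. If `a` is far
    -- from `w`, it must rank below `b`, for otherwise `monotone` would make `a` near `w` as well.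
    lowers<uppers : ∀ {l u} → l ∈ₗ lowers → u ∈ₗ uppers → l < u
    lowers<uppers {l} {u} l∈ u∈ with ∈-map⁻ _ u∈
    ... | b , b∈ , refl with ∈-filter⁻ (λ u → E? u w) {xs = earlier} b∈ | ∈-++⁻ (map x earlier) l∈
    ...   | b∈′ , Ebw | inj₁ l∈′ with ∈-map⁻ _ l∈′
    ...     | a , a∈ , refl = near ok (earlier-< b∈′) (earlier-< a∈)
              (monotone ℕₚ.≤-refl (ℕₚ.<⇒≤ (subst (π a ℕ.<_) (sym πw) (earlier-< a∈))) Ebw)
    lowers<uppers {l} {u} l∈ u∈ | b , b∈ , refl | b∈′ , Ebw | inj₂ l∈′ with ∈-map⁻ _ l∈′
    ...     | a , a∈ , refl with ∈-filter⁻ (λ u → ¬? (E? u w)) {xs = earlier} a∈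
    ...       | a∈′ , ¬Eaw = +-monoˡ-< 1ℚ (increasing ok (earlier-< a∈′) (earlier-< b∈′)
                  (ℕₚ.≰⇒> λ b≤a → ¬Eaw (monotone b≤a ℕₚ.≤-refl Ebw)))

    chosen : ∃[ z ] All (_< z) lowers × All (z <_) uppers
    chosen = between lowers uppers lowers<uppers

    z : ℚ
    z = proj₁ chosen

    lower<z : ∀ {l} → l ∈ₗ lowers → l < z
    lower<z = All.lookup (proj₁ (proj₂ chosen))

    z<upper : ∀ {l} → l ∈ₗ uppers → z < l
    z<upper = All.lookup (proj₂ (proj₂ chosen))

    x′ : Fin n → ℚ
    x′ u with π u ℕₚ.≟ r
    ... | yes _ = z
    ... | no  _ = x u

    ok′ : RealizedBelow (suc r) x′
    increasing ok′ {u} {v} u≤r v≤r u<v with π u ℕₚ.≟ r | π v ℕₚ.≟ r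
    ... | yes refl | _        = contradiction (ℕₚ.<-≤-trans u<v (ℕₚ.≤-pred v≤r)) (ℕₚ.<-irrefl refl)
    ... | no u≢r   | yes refl = lower<z (∈-++⁺ˡ (∈-map⁺ x (∈-earlier (<-suc u≤r u≢r))))
    ... | no u≢r   | no v≢r   = increasing ok (<-suc u≤r u≢r) (<-suc v≤r v≢r) u<v
    near ok′ {u} {v} u≤r v≤r Euv with π u ℕₚ.≟ r | π v ℕₚ.≟ r
    ... | yes _  | yes _ = p<p+1 z
    ... | yes _  | no v≢r = <-trans (lower<z (∈-++⁺ˡ (∈-map⁺ x (∈-earlier (<-suc v≤r v≢r))))) (p<p+1 z)
    ... | no u≢r | yes v≡r = z<upper (∈-map⁺ _ (∈-filter⁺ _ (∈-earlier (<-suc u≤r u≢r))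
                               (monotone ℕₚ.≤-refl (ℕₚ.≤-reflexive (trans πw (sym v≡r))) Euv)))
    ... | no u≢r | no v≢r = near ok (<-suc u≤r u≢r) (<-suc v≤r v≢r) Euv
    far ok′ {u} {v} u≤r v≤r ¬Euv with π u ℕₚ.≟ r | π v ℕₚ.≟ r
    ... | yes refl | _ = contradiction (downward (ℕₚ.≤-pred v≤r)) ¬Euv
    ... | no u≢r | yes v≡r = lower<z (∈-++⁺ʳ (map x earlier) (∈-map⁺ _ (∈-filter⁺ _ (∈-earlier (<-suc u≤r u≢r))
                               λ Euw → ¬Euv (monotone ℕₚ.≤-refl (ℕₚ.≤-reflexive (trans v≡r (sym πw))) Euw))))
    ... | no u≢r | no v≢r = far ok (<-suc u≤r u≢r) (<-suc v≤r v≢r) ¬Euv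

  realizedBelow : ∀ r → ∃ (RealizedBelow r)
  realizedBelow zero    = (λ _ → 0ℚ) , record { increasing = λ () ; near = λ () ; far = λ () }
  realizedBelow (suc r) with realizedBelow r | any? (λ w → π w ℕₚ.≟ r)
  ... | x , ok | yes (w , πw) = Step.x′ r x ok w πw , Step.ok′ r x ok w πw
  ... | x , ok | no ∄w = x , record
    { increasing = λ u≤r v≤r → increasing ok (<r u≤r) (<r v≤r)
    ; near       = λ u≤r v≤r → near ok (<r u≤r) (<r v≤r)
    ; far        = λ u≤r v≤r → far ok (<r u≤r) (<r v≤r)
    }
    where
    <r : ∀ {u} → π u ℕ.< suc r → π u ℕ.< r
    <r {u} u≤r = <-suc u≤r (λ πu → ∄w (u , πu))

  realize : ∀ m → (∀ u → π u ℕ.< m) → Σ[ x ∈ (Fin n → ℚ) ] (∀ u v → E u v ⇔ x v ℚ.≤ x u + 1ℚ)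
  realize m π<m with realizedBelow m
  ... | x , ok = x , λ u v → mk⇔ (<⇒≤ ∘ near ok (π<m u) (π<m v)) (back u v)
    where
    back : ∀ u v → x v ℚ.≤ x u + 1ℚ → E u v
    back u v xv≤ with E? u v
    ... | yes Euv = Euv
    ... | no ¬Euv = ⊥-elim (<-irrefl refl (<-≤-trans (far ok (π<m u) (π<m v) ¬Euv) xv≤))

-- Reading `R` as `≤`, the rank of `u` is the number of points strictly below it. If `R u v` fails,
-- the points below `v` form a proper subset of those below `u`, as `v` itself is below `u` only; so
-- the rank of `u` is larger.
rank : ∀ {n} (R : Fin n → Fin n → Set) (R? : ∀ u v → Dec (R u v)) →
       (∀ u v → R u v ⊎ R v u) → (∀ {u v w} → R u v → R v w → R u w) →
       Σ[ π ∈ (Fin n → Fin (suc n)) ] (∀ {u v} → toℕ (π u) ℕ.≤ toℕ (π v) → R u v)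
rank {n} R R? total R-trans = (λ u → fromℕ< (s≤s (∣p∣≤n (p u)))) , reflect
  where
  p : Fin n → Subset n
  p u = tabulate (λ w → not (does (R? u w)))

  R-refl : ∀ u → R u u
  R-refl u = [ (λ r → r) , (λ r → r) ]′ (total u u)

  ∈p⁺ : ∀ {u w} → ¬ R u w → p u Vec.[ w ]= inside
  ∈p⁺ {u} {w} ¬Ruw = lookup⇒[]= w (p u) (trans (lookup∘tabulate _ w) (cong not (Dec.dec-false (R? u w) ¬Ruw)))

  ∈p⁻ : ∀ {u w} → p u Vec.[ w ]= inside → ¬ R u w
  ∈p⁻ {u} {w} w∈ Ruw with trans (sym ([]=⇒lookup w∈)) (trans (lookup∘tabulate _ w) (cong not (Dec.dec-true (R? u w) Ruw)))
  ... | ()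

  grow : ∀ {u v} → ¬ R u v → p v ⊂ p u
  grow {u} {v} ¬Ruv = (λ w∈pv → ∈p⁺ λ Ruw → ∈p⁻ w∈pv (R-trans Rvu Ruw))
                    , v , ∈p⁺ ¬Ruv , λ v∈pv → ∈p⁻ v∈pv (R-refl v)
    where
    Rvu : R v u
    Rvu = [ (λ r → contradiction r ¬Ruv) , (λ r → r) ]′ (total u v)

  reflect : ∀ {u v} → toℕ (fromℕ< (s≤s (∣p∣≤n (p u)))) ℕ.≤ toℕ (fromℕ< (s≤s (∣p∣≤n (p v)))) → R u v
  reflect {u} {v} le with R? u v
  ... | yes r = r
  ... | no ¬r = ⊥-elim (ℕₚ.<⇒≱ (p⊂q⇒∣p∣<∣q∣ (grow ¬r)) (subst₂ ℕ._≤_ (toℕ-fromℕ< _) (toℕ-fromℕ< _) le))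

-- Decidability of cubicity

open ℝ

-- For `q < r` with `r` below `y`, locatedness of `x` puts `q` below `x`, as wanted, or `r` above
-- `x`; the latter separates `x` from `y` and would give `x ≤ᴿ y`.
≤ᴿ-reverse : ∀ {x y} → ¬ (x ≤ᴿ y) → y ≤ᴿ x
≤ᴿ-reverse {x} {y} x≰y {q} q∈ with lower-open y q∈
... | r , q<r , r∈y with located x q<r
...   | inj₁ q∈x = q∈x
...   | inj₂ r∈x = ⊥-elim (x≰y λ {p} p∈x → lower-closed y (lower<upper x p∈x r∈x) r∈y)

x≤x+1 : ∀ x → x ≤ᴿ x +1
x≤x+1 x = lower-closed x (p-1<p _)

p-1+1≡p : ∀ p → p - 1ℚ + 1ℚ ≡ p
p-1+1≡p p = trans (+-assoc p (- 1ℚ) 1ℚ) (trans (cong (λ z → p + z) (+-inverseˡ 1ℚ)) (+-identityʳ p))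

p+1-1≡p : ∀ p → p + 1ℚ - 1ℚ ≡ p
p+1-1≡p p = trans (+-assoc p 1ℚ (- 1ℚ)) (trans (cong (λ z → p + z) (+-inverseʳ 1ℚ)) (+-identityʳ p))

fromℚ-mono : ∀ {a b} → a ℚ.≤ b → fromℚ a ≤ᴿ fromℚ b
fromℚ-mono a≤b q<a = <-≤-trans q<a a≤b

fromℚ-≤+1 : ∀ {a b} → fromℚ a ≤ᴿ fromℚ b +1 ⇔ a ℚ.≤ b + 1ℚ
fromℚ-≤+1 {a} {b} = mk⇔
  (λ le → ≮⇒≥ λ b+1<a → <-irrefl (p+1-1≡p b) (le b+1<a))
  (λ a≤b+1 {q} q<a → <-respʳ-≡ (p+1-1≡p b) (+-monoˡ-< (- 1ℚ) (<-≤-trans q<a a≤b+1)))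

-- In each coordinate the larger of the two offsets is a common point of the two unit intervals;
-- `total` says which one it is.
cubes-meet : ∀ {k} {a b : Vector ℝ k} →
             (∀ i → a i ≤ᴿ b i ⊎ b i ≤ᴿ a i) → (∀ i → a i ≤ᴿ b i +1 × b i ≤ᴿ a i +1) →
             ∃[ p ] cube a p × cube b p
cubes-meet {a = a} {b} total near =
  (λ i → proj₁ (meet i)) , (λ i → proj₁ (proj₂ (meet i))) , (λ i → proj₂ (proj₂ (meet i)))
  where
  meet : ∀ i → Σ[ p ∈ ℝ ] (a i ≤ᴿ p × p ≤ᴿ a i +1) × (b i ≤ᴿ p × p ≤ᴿ b i +1)
  meet i with total i
  ... | inj₁ a≤b = b i , (a≤b , proj₂ (near i)) , id , x≤x+1 (b i)
  ... | inj₂ b≤a = a i , (id , x≤x+1 (a i)) , b≤a , proj₁ (near i)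

cubes-near : ∀ {k} {a b : Vector ℝ k} → ∃[ p ] cube a p × cube b p →
             ∀ i → a i ≤ᴿ b i +1 × b i ≤ᴿ a i +1
cubes-near {a = a} {b} (p , p∈a , p∈b) i =
    (λ q∈ → proj₂ (p∈b i) (proj₁ (p∈a i) q∈)) , (λ q∈ → proj₂ (p∈a i) (proj₁ (p∈b i) q∈))

-- Lets finitely many comparisons of reals be taken as decided in the proof of a stable statement.
¬¬-Π : ∀ {n} {P : Fin n → Set} → (∀ i → ¬ ¬ P i) → ¬ ¬ (∀ i → P i)
¬¬-Π = sequence (RawMonad.rawApplicative ¬¬-Monad)

Near : ℚ → ℚ → Set
Near x y = y ℚ.≤ x + 1ℚ × x ℚ.≤ y + 1ℚ

RationallyRepresentable : Graph → ℕ → Set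
RationallyRepresentable G k = Σ[ x ∈ (Vertex G → Vector ℚ k) ]
  (∀ u v → u ≢ v → Adj G u v ⇔ (∀ i → Near (x u i) (x v i)))

rational⇒cube : ∀ {G k} → RationallyRepresentable G k → CubeRepresentable G k
rational⇒cube {G} {k} (x , adj⇔near) = pos , λ u v u≢v →
  let open Equivalence (adj⇔near u v u≢v) in mk⇔
    (λ adj → cubes-meet {a = pos u} {pos v} (λ i → total (x u i) (x v i))
      (λ i → let (near₁ , near₂) = to adj i in
        Equivalence.from (fromℚ-≤+1 {x u i} {x v i}) near₂ , Equivalence.from (fromℚ-≤+1 {x v i} {x u i}) near₁))
    (λ meets → from λ i → let (near₁ , near₂) = cubes-near {a = pos u} {pos v} meets i in
        Equivalence.to (fromℚ-≤+1 {x v i} {x u i}) near₂ , Equivalence.to (fromℚ-≤+1 {x u i} {x v i}) near₁)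
  where
  pos : Vertex G → Vector ℝ k
  pos u i = fromℚ (x u i)

  total : ∀ p q → fromℚ p ≤ᴿ fromℚ q ⊎ fromℚ q ≤ᴿ fromℚ p
  total p q with ℚₚ.≤-total p q
  ... | inj₁ p≤q = inj₁ (fromℚ-mono p≤q)
  ... | inj₂ q≤p = inj₂ (fromℚ-mono q≤p)

module Decide (G : Graph) (Adj? : ∀ u v → Dec (Adj G u v)) where

  n : ℕ
  n = proj₁ (finite G)

  index : Vertex G → Fin n
  index = Inverse.to (proj₂ (finite G))

  vertex : Fin n → Vertex G
  vertex = Inverse.from (proj₂ (finite G))

  vertex-index : ∀ x → vertex (index x) ≡ x
  vertex-index = Inverse.strictlyInverseʳ (proj₂ (finite G))

  index-vertex : ∀ u → index (vertex u) ≡ u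
  index-vertex = Inverse.strictlyInverseˡ (proj₂ (finite G))

  Layout : Set
  Layout = Vec (Fin (suc n)) n × Vec (Vec Bool n) n

  π : Layout → Fin n → ℕ
  π (ranks , _) u = toℕ (lookup ranks u)

  E : Layout → Fin n → Fin n → Set
  E (_ , reach) u v = lookup (lookup reach u) v ≡ true

  E? : ∀ c u v → Dec (E c u v)
  E? (_ , reach) u v = lookup (lookup reach u) v Boolₚ.≟ true

  Valid : Layout → Set
  Valid c = IsSemiorder (π c) (E c)

  valid? : Decidable Valid
  valid? c = map′
    (λ (d , m) → record { downward = λ {u} {v} → d u v ; monotone = λ {u} {v} {u′} {v′} → m u v u′ v′ })
    (λ s → (λ u v → IsSemiorder.downward s) , λ u v u′ v′ → IsSemiorder.monotone s)
    (all? (λ u → all? λ v → (π c v ℕₚ.≤? π c u) →-dec E? c u v)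
     ×-dec
     all? (λ u → all? λ v → all? λ u′ → all? λ v′ →
       (π c u ℕₚ.≤? π c u′) →-dec ((π c v′ ℕₚ.≤? π c v) →-dec (E? c u v →-dec E? c u′ v′))))

  Represents : ∀ {k} → Vec Layout k → Set
  Represents cs = (∀ i → Valid (lookup cs i)) ×
    (∀ u v → u ≢ v →
      (Adj G (vertex u) (vertex v) → ∀ i → E (lookup cs i) u v × E (lookup cs i) v u) ×
      ((∀ i → E (lookup cs i) u v × E (lookup cs i) v u) → Adj G (vertex u) (vertex v)))

  represents? : ∀ {k} → Decidable (Represents {k})
  represents? cs = all? (λ i → valid? (lookup cs i)) ×-dec
    all? λ u → all? λ v → ¬? (u Finₚ.≟ v) →-dec
      ((Adj? (vertex u) (vertex v) →-dec near? u v) ×-dec (near? u v →-dec Adj? (vertex u) (vertex v)))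
    where
    near? : ∀ u v → Dec (∀ i → E (lookup cs i) u v × E (lookup cs i) v u)
    near? u v = all? λ i → E? (lookup cs i) u v ×-dec E? (lookup cs i) v u

  LayoutRepresentable : ℕ → Set
  LayoutRepresentable k = Σ[ cs ∈ Vec Layout k ] Represents cs

  layoutRepresentable? : Decidable LayoutRepresentable
  layoutRepresentable? k =
    searchVec k (search-× (searchVec n any?) (searchVec n (searchVec n searchBool))) represents?

  layout⇒rational : ∀ {k} → LayoutRepresentable k → RationallyRepresentable G k
  layout⇒rational {k} (cs , valid , adj⇔near) = (λ x i → proj₁ (line i) (index x)) , λ x y x≢y →
    let (f , g) = adj⇔near (index x) (index y)
                    (λ eq → x≢y (trans (sym (vertex-index x)) (trans (cong vertex eq) (vertex-index y))))
        adj≡    = cong₂ (Adj G) (vertex-index x) (vertex-index y)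
    in mk⇔ (λ adj i → let (e₁ , e₂) = f (subst id (sym adj≡) adj) i in
                      Equivalence.to (proj₂ (line i) _ _) e₁ , Equivalence.to (proj₂ (line i) _ _) e₂)
           (λ near → subst id adj≡ (g λ i → let (n₁ , n₂) = near i in
                      Equivalence.from (proj₂ (line i) _ _) n₁ , Equivalence.from (proj₂ (line i) _ _) n₂))
    where
    line : ∀ i → Σ[ x ∈ (Fin n → ℚ) ] (∀ u v → E (lookup cs i) u v ⇔ x v ℚ.≤ x u + 1ℚ)
    line i = Realize.realize (π c) (E c) (E? c) (valid i) (suc n) (λ u → toℕ<n (lookup (proj₁ c) u))
      where c = lookup cs i

  -- The conclusion is decidable, hence stable under double negation, so all comparisons among the
  -- finitely many real offsets may be assumed decided. The layout then records their ranks and the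
  -- outcomes of the comparisons with `+1`.
  cube⇒layout : ∀ {k} → CubeRepresentable G k → LayoutRepresentable k
  cube⇒layout {k} (a , adj⇔meet) = decidable-stable (layoutRepresentable? k) $
    ¬¬-map (λ dec → Extract.result (λ u v i → proj₁ (dec u v i)) (λ u v i → proj₂ (dec u v i)))
      (¬¬-Π λ u → ¬¬-Π λ v → ¬¬-Π λ i → decided u v i)
    where
    pos : Fin n → Fin k → ℝ
    pos u = a (vertex u)

    decided : ∀ u v i → ¬ ¬ (Dec (pos u i ≤ᴿ pos v i) × Dec (pos v i ≤ᴿ pos u i +1))
    decided u v i ¬d = ¬¬-excluded-middle λ d₁ → ¬¬-excluded-middle λ d₂ → ¬d (d₁ , d₂)

    module Extract (≤? : ∀ u v i → Dec (pos u i ≤ᴿ pos v i))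
                   (≤+1? : ∀ u v i → Dec (pos v i ≤ᴿ pos u i +1)) where

      total : ∀ i u v → pos u i ≤ᴿ pos v i ⊎ pos v i ≤ᴿ pos u i
      total i u v with ≤? u v i
      ... | yes le = inj₁ le
      ... | no ¬le = inj₂ (≤ᴿ-reverse {pos u i} {pos v i} ¬le)

      ranks : ∀ i → Σ[ π ∈ (Fin n → Fin (suc n)) ] (∀ {u v} → toℕ (π u) ℕ.≤ toℕ (π v) → pos u i ≤ᴿ pos v i)
      ranks i = rank (λ u v → pos u i ≤ᴿ pos v i) (λ u v → ≤? u v i) (total i) (λ u≤v v≤w q∈ → v≤w (u≤v q∈))

      layout : Fin k → Layout
      layout i = tabulate (proj₁ (ranks i)) , tabulate λ u → tabulate λ v → does (≤+1? u v i)

      lookup-E : ∀ i u v → lookup (lookup (proj₂ (layout i)) u) v ≡ does (≤+1? u v i)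
      lookup-E i u v = trans (cong (λ w → lookup w v) (lookup∘tabulate (λ u → tabulate λ v → does (≤+1? u v i)) u))
                             (lookup∘tabulate _ v)

      E⁺ : ∀ i {u v} → pos v i ≤ᴿ pos u i +1 → E (layout i) u v
      E⁺ i {u} {v} le = trans (lookup-E i u v) (Dec.dec-true (≤+1? u v i) le)

      E⁻ : ∀ i {u v} → E (layout i) u v → pos v i ≤ᴿ pos u i +1
      E⁻ i {u} {v} e with ≤+1? u v i | trans (sym (lookup-E i u v)) e
      ... | yes le | _ = le
      ... | no  _  | ()

      rank-≤ : ∀ i {u v} → π (layout i) u ℕ.≤ π (layout i) v → pos u i ≤ᴿ pos v i
      rank-≤ i {u} {v} le = proj₂ (ranks i)
        (subst₂ (λ x y → toℕ x ℕ.≤ toℕ y) (lookup∘tabulate _ u) (lookup∘tabulate _ v) le)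

      valid : ∀ i → Valid (layout i)
      valid i = record
        { downward = λ {u} {v} v≤u → E⁺ i λ q∈ → x≤x+1 (pos u i) (rank-≤ i v≤u q∈)
        ; monotone = λ {u} {v} {u′} {v′} u≤u′ v′≤v e → E⁺ i λ q∈ → rank-≤ i u≤u′ (E⁻ i e (rank-≤ i v′≤v q∈))
        }

      represents : ∀ u v → u ≢ v →
        (Adj G (vertex u) (vertex v) → ∀ i → E (layout i) u v × E (layout i) v u) ×
        ((∀ i → E (layout i) u v × E (layout i) v u) → Adj G (vertex u) (vertex v))
      represents u v u≢v =
          (λ adj i → let (n₁ , n₂) = cubes-near {a = pos u} {pos v} (to adj) i in E⁺ i n₂ , E⁺ i n₁)
        , (λ e → from (cubes-meet {a = pos u} {pos v} (λ i → total i u v) (λ i → E⁻ i (proj₂ (e i)) , E⁻ i (proj₁ (e i)))))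
        where
        open Equivalence (adj⇔meet (vertex u) (vertex v)
          (λ eq → u≢v (trans (sym (index-vertex u)) (trans (cong index eq) (index-vertex v)))))

      result : LayoutRepresentable k
      result = tabulate layout
             , (λ i → subst Valid (sym (lookup∘tabulate layout i)) (valid i))
             , λ u v u≢v → let (f , g) = represents u v u≢v in
                 (λ adj i → subst (λ c → E c u v × E c v u) (sym (lookup∘tabulate layout i)) (f adj i))
               , (λ e → g λ i → subst (λ c → E c u v × E c v u) (lookup∘tabulate layout i) (e i))

least : ∀ {P : ℕ → Set} → Decidable P → ∀ {m} → P m → ∃[ k ] k ℕ.≤ m × P k × (∀ j → P j → k ℕ.≤ j)
least P? {zero} p = 0 , z≤n , p , λ _ _ → z≤n
least {P} P? {suc m} p with P? 0
... | yes p₀ = 0 , z≤n , p₀ , λ _ _ → z≤n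
... | no ¬p₀ with least (P? ∘ suc) {m} p
...   | k , k≤m , pk , min = suc k , s≤s k≤m , pk , λ { zero p₀ → contradiction p₀ ¬p₀ ; (suc j) pj → s≤s (min j pj) }

-- Cubes, layouts and rational offsets are available in the same dimensions, and for layouts this is
-- decidable, so a least dimension can be found. The rational representation is returned too,
-- because the lower bound is proved for rational offsets.
cubicity : ∀ G → (∀ u v → Dec (Adj G u v)) → ∀ {m} → RationallyRepresentable G m →
           ∃[ k ] k ℕ.≤ m × IsCubicity G k × RationallyRepresentable G k
cubicity G Adj? rep with least layoutRepresentable? (cube⇒layout (rational⇒cube {G} rep))
  where open Decide G Adj?
... | k , k≤m , q , min = k , k≤m , (rational⇒cube {G} (layout⇒rational q) , λ j → min j ∘ cube⇒layout)
                        , layout⇒rational q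
  where open Decide G Adj?

-- Lower bound

lookup-ext : ∀ {A : Set} {n} {u v : Vec A n} → (∀ i → lookup u i ≡ lookup v i) → u ≡ v
lookup-ext {u = u} {v} eq = trans (sym (tabulate∘lookup u)) (trans (tabulate-cong eq) (tabulate∘lookup v))

Adj? : ∀ d u v → Dec (Adj (H d) u v)
Adj? d u v = any? λ i → differ? i ×-dec
  map′ (λ uniq {j} → uniq j) (λ uniq j → uniq {j}) (all? λ j → differ? j →-dec (i Finₚ.≟ j))
  where
  differ? : ∀ i → Dec (lookup u i ≢ lookup v i)
  differ? i = ¬? (lookup u i Boolₚ.≟ lookup v i)

adj-tail : ∀ {d} b {u v} → Adj (H d) u v → Adj (H (suc d)) (b ∷ u) (b ∷ v)
adj-tail b (i , u≢v , uniq) = suc i , u≢v , λ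
  { {zero}  b≢b → contradiction refl b≢b
  ; {suc j} neq → cong suc (uniq neq) }

adj-head : ∀ {d} {a b} u → a ≢ b → Adj (H (suc d)) (a ∷ u) (b ∷ u)
adj-head u a≢b = zero , a≢b , λ
  { {zero}  _   → refl
  ; {suc j} neq → contradiction refl neq }

adj-∷⁻ : ∀ {d a b u v} → Adj (H (suc d)) (a ∷ u) (b ∷ v) → (a ≢ b × u ≡ v) ⊎ (a ≡ b × Adj (H d) u v)
adj-∷⁻ {u = u} {v} (zero , a≢b , uniq) =
  inj₁ (a≢b , lookup-ext λ j → decidable-stable (lookup u j Boolₚ.≟ lookup v j) λ neq → contradiction (uniq {suc j} neq) λ ())
adj-∷⁻ {a = a} {b} (suc i , neq , uniq) =
  inj₂ (decidable-stable (a Boolₚ.≟ b) (λ a≢b → contradiction (uniq {zero} a≢b) λ ())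
       , i , neq , λ neq′ → Finₚ.suc-injective (uniq neq′))

parity : ∀ {d} → Vec Bool d → Bool
parity []      = false
parity (b ∷ v) = b xor parity v

adj⇒parity≢ : ∀ {d} (u v : Vec Bool d) → Adj (H d) u v → parity u ≢ parity v
adj⇒parity≢ [] [] (() , _)
adj⇒parity≢ (a ∷ u) (b ∷ v) adj eq with adj-∷⁻ adj
... | inj₁ (a≢b , refl) = a≢b (xor-cancelʳ a b (parity u) eq)
  where
  xor-cancelʳ : ∀ a b c → a xor c ≡ b xor c → a ≡ b
  xor-cancelʳ true  true  c eq = refl
  xor-cancelʳ false false c eq = refl
  xor-cancelʳ true  false c eq = contradiction (sym eq) (Boolₚ.not-¬ refl)
  xor-cancelʳ false true  c eq = contradiction eq (Boolₚ.not-¬ refl)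
... | inj₂ (refl , adj′) = adj⇒parity≢ u v adj′ (xor-cancelˡ a eq)
  where
  xor-cancelˡ : ∀ a {b c} → a xor b ≡ a xor c → b ≡ c
  xor-cancelˡ true  eq = Boolₚ.not-injective eq
  xor-cancelˡ false eq = eq

-- Adding and subtracting a natural number one unit at a time. `plus` acts on its argument and
-- `minus` on its result, so that the innermost units of `plus n (minus n q)` cancel first.
plus minus : ℕ → ℚ → ℚ
plus zero    q = q
plus (suc n) q = plus n (q + 1ℚ)
minus zero    q = q
minus (suc n) q = minus n q - 1ℚ

plus-mono : ∀ n {p q} → p ℚ.≤ q → plus n p ℚ.≤ plus n q
plus-mono zero    p≤q = p≤q
plus-mono (suc n) p≤q = plus-mono n (ℚₚ.+-monoˡ-≤ 1ℚ p≤q)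

minus-mono : ∀ n {p q} → p ℚ.≤ q → minus n p ℚ.≤ minus n q
minus-mono zero    p≤q = p≤q
minus-mono (suc n) p≤q = ℚₚ.+-monoˡ-≤ (- 1ℚ) (minus-mono n p≤q)

plus-minus : ∀ n q → plus n (minus n q) ≡ q
plus-minus zero    q = refl
plus-minus (suc n) q = trans (cong (plus n) (p-1+1≡p (minus n q))) (plus-minus n q)

minus-plus : ∀ n q → minus n (plus n q) ≡ q
minus-plus zero    q = refl
minus-plus (suc n) q = trans (cong (_- 1ℚ) (minus-plus n (q + 1ℚ))) (p+1-1≡p q)

plus-plus : ∀ m n q → plus m (plus n q) ≡ plus (n ℕ.+ m) q
plus-plus m zero    q = refl
plus-plus m (suc n) q = plus-plus m n (q + 1ℚ)

Cell : ℚ → ℕ → ℚ → Set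
Cell lo t x = plus t lo ℚ.≤ x × x ℚ.≤ plus t lo + 1ℚ

-- The closed cells share endpoints; the first cell that fits is taken.
cell : ∀ n lo x → lo ℚ.≤ x → x ℚ.≤ plus (suc n) lo → ∃[ t ] Cell lo (toℕ {suc n} t) x
cell n lo x lo≤x x≤hi with x ℚₚ.≤? lo + 1ℚ
cell n       lo x lo≤x x≤hi | yes x≤lo+1 = zero , lo≤x , x≤lo+1
cell zero    lo x lo≤x x≤hi | no  x≰lo+1 = contradiction x≤hi x≰lo+1
cell (suc n) lo x lo≤x x≤hi | no  x≰lo+1 =
  let (t , c) = cell n (lo + 1ℚ) x (<⇒≤ (ℚₚ.≰⇒> x≰lo+1)) x≤hi in suc t , c

same-cell⇒≤ : ∀ lo t {x y} → Cell lo t x → Cell lo t y → y ℚ.≤ x + 1ℚ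
same-cell⇒≤ lo t (lo≤x , _) (_ , y≤hi) = ℚₚ.≤-trans y≤hi (ℚₚ.+-monoˡ-≤ 1ℚ lo≤x)

-- Walk from `u` to `v` by correcting one bit at a time: at most `d` steps, each changing `g` by at
-- most 1.
lipschitz : ∀ {d} (g : Vec Bool d → ℚ) → (∀ u v → Adj (H d) u v → g u ℚ.≤ g v + 1ℚ) →
            ∀ u v → g u ℚ.≤ plus d (g v)
lipschitz g lip []      []      = ℚₚ.≤-refl
lipschitz {suc d} g lip (a ∷ u) (b ∷ v) =
  ℚₚ.≤-trans (lipschitz (g ∘ (a ∷_)) (λ u v adj → lip (a ∷ u) (a ∷ v) (adj-tail a adj)) u v)
             (plus-mono d step)
  where
  step : g (a ∷ v) ℚ.≤ g (b ∷ v) + 1ℚ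
  step with a Boolₚ.≟ b
  ... | yes refl = <⇒≤ (p<p+1 (g (a ∷ v)))
  ... | no a≢b   = lip _ _ (adj-head v a≢b)

rational⇒2^e≤ : ∀ e {k} → RationallyRepresentable (H (suc e)) k → 2 ^ e ℕ.≤ (suc e ℕ.+ suc e) ^ k
rational⇒2^e≤ e {k} (x , adj⇔near) = ℕₚ.≮⇒≥ λ few → collision (pigeonhole few code)
  where
  d = suc e

  origin : Vec Bool d
  origin = Vec.replicate d false

  lip : ∀ i u v → Adj (H d) u v → x u i ℚ.≤ x v i + 1ℚ
  lip i u v adj with Equivalence.to (adj⇔near u v (λ { refl → irreflexive (H d) {u} refl adj })) adj i
  ... | _ , le = le

  -- All offsets lie within `d` of that of `origin`, hence in a window of length `2d` starting at
  -- `lo`.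
  lo : Fin k → ℚ
  lo i = minus d (x origin i)

  lo≤ : ∀ i u → lo i ℚ.≤ x u i
  lo≤ i u = subst (lo i ℚ.≤_) (minus-plus d (x u i)) (minus-mono d (lipschitz (λ u → x u i) (lip i) origin u))

  ≤hi : ∀ i u → x u i ℚ.≤ plus (d ℕ.+ d) (lo i)
  ≤hi i u = subst (x u i ℚ.≤_) (trans (cong (plus d) (sym (plus-minus d (x origin i)))) (plus-plus d d (lo i)))
                  (lipschitz (λ u → x u i) (lip i) u origin)

  cellOf : ∀ u i → ∃[ t ] Cell (lo i) (toℕ {d ℕ.+ d} t) (x u i)
  cellOf u i = cell (e ℕ.+ d) (lo i) (x u i) (lo≤ i u) (≤hi i u)

  open Inverse (proj₂ (finite (H e))) using () renaming (from to word; strictlyInverseˡ to index-word; to to index)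

  -- The leading bit is the parity of the rest, which makes the total weight even and leaves `e`
  -- free bits.
  even : Fin (2 ^ e) → Vec Bool d
  even j = parity (word j) ∷ word j

  even-parity : ∀ j → parity (even j) ≡ false
  even-parity j = Boolₚ.xor-same (parity (word j))

  code : Fin (2 ^ e) → Fin ((d ℕ.+ d) ^ k)
  code j = funToFin (λ i → proj₁ (cellOf (even j) i))

  collision : ¬ (∃[ i ] ∃[ j ] i Fin.< j × code i ≡ code j)
  collision (j , j′ , j<j′ , eq) = adj⇒parity≢ (even j) (even j′) adj
    (trans (even-parity j) (sym (even-parity j′)))
    where
    even≢ : even j ≢ even j′
    even≢ eq′ = Finₚ.<⇒≢ j<j′ (trans (sym (index-word j)) (trans (cong index (∷-injectiveʳ eq′)) (index-word j′)))

    same : ∀ i → proj₁ (cellOf (even j) i) ≡ proj₁ (cellOf (even j′) i)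
    same i = trans (sym (finToFun-funToFin _ i)) (trans (cong (λ c → finToFun c i) eq) (finToFun-funToFin _ i))

    adj : Adj (H d) (even j) (even j′)
    adj = Equivalence.from (adj⇔near (even j) (even j′) even≢) λ i →
      let t  = toℕ (proj₁ (cellOf (even j) i))
          c  = proj₂ (cellOf (even j) i)
          c′ = subst (λ t → Cell (lo i) (toℕ t) (x (even j′) i)) (sym (same i)) (proj₂ (cellOf (even j′) i))
      in same-cell⇒≤ (lo i) t c c′ , same-cell⇒≤ (lo i) t c′ c

-- A detecting matrix

sum-zero : ∀ {d} (v : Fin d → ℤ) → (∀ i → v i ≡ 0ℤ) → sum v ≡ 0ℤ
sum-zero {d} v v≡0 = trans (sum-cong-≗ v≡0) (sum-replicate-zero d)

sum-single : ∀ {d} (v : Fin d → ℤ) j → (∀ i → i ≢ j → v i ≡ 0ℤ) → sum v ≡ v j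
sum-single v zero    off = trans (cong (λ s → v zero ℤ.+ s) (sum-zero (v ∘ suc) λ i → off (suc i) λ ()))
                                 (ℤₚ.+-identityʳ (v zero))
sum-single v (suc j) off = trans (cong₂ ℤ._+_ (off zero λ ())
                                   (sum-single (v ∘ suc) j λ i i≢j → off (suc i) (i≢j ∘ Finₚ.suc-injective)))
                                 (ℤₚ.+-identityˡ (v (suc j)))

AtMostOne : ∀ {d} → (Fin d → ℤ) → Set
AtMostOne v = ∀ {i j} → v i ≢ 0ℤ → v j ≢ 0ℤ → i ≡ j

sum-atMostOne : ∀ {d} (v : Fin d → ℤ) → AtMostOne v → (∀ j → ∣ v j ∣ ℕ.≤ 1) → ∣ sum v ∣ ℕ.≤ 1
sum-atMostOne v single v≤1 with any? (λ j → ¬? (v j ℤₚ.≟ 0ℤ))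
... | yes (j , vj≢0) = subst (λ s → ∣ s ∣ ℕ.≤ 1)
        (sym (sum-single v j λ i i≢j → decidable-stable (v i ℤₚ.≟ 0ℤ) λ vi≢0 → i≢j (single vi≢0 vj≢0))) (v≤1 j)
... | no ∄ = subst (λ s → ∣ s ∣ ℕ.≤ 1)
        (sym (sum-zero v λ i → decidable-stable (v i ℤₚ.≟ 0ℤ) λ vi≢0 → ∄ (i , vi≢0))) z≤n

dot : ∀ {d} → (Fin d → ℤ) → (Fin d → ℤ) → ℤ
dot w z = sum (λ j → w j ℤ.* z j)

dot-cong : ∀ {d} {v w : Fin d → ℤ} (z : Fin d → ℤ) → (∀ j → v j ≡ w j) → dot v z ≡ dot w z
dot-cong z eq = sum-cong-≗ λ j → cong (ℤ._* z j) (eq j)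

dot-+ : ∀ {d} (v w z : Fin d → ℤ) → dot (λ j → v j ℤ.+ w j) z ≡ dot v z ℤ.+ dot w z
dot-+ v w z = trans (sum-cong-≗ λ j → ℤₚ.*-distribʳ-+ (z j) (v j) (w j)) (∑-distrib-+ (λ j → v j ℤ.* z j) (λ j → w j ℤ.* z j))

dot-* : ∀ {d} c (w z : Fin d → ℤ) → dot (λ j → c ℤ.* w j) z ≡ c ℤ.* dot w z
dot-* c w z = trans (sum-cong-≗ λ j → ℤₚ.*-assoc c (w j) (z j)) (sym (*-distribˡ-sum c (λ j → w j ℤ.* z j)))

dot-minus : ∀ {d} (w x y : Fin d → ℤ) → dot w (λ j → x j ℤ.- y j) ≡ dot w x ℤ.- dot w y
dot-minus w x y = trans (sum-cong-≗ λ j → expand (w j) (x j) (y j))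
  (trans (∑-distrib-+ (λ j → w j ℤ.* x j) (λ j → -1ℤ ℤ.* (w j ℤ.* y j)))
         (cong (λ s → dot w x ℤ.+ s) (trans (sym (*-distribˡ-sum -1ℤ (λ j → w j ℤ.* y j))) (ℤₚ.-1*i≡-i (dot w y)))))
  where
  open +-*-Solver using (solve; _:=_; _:+_; _:-_; _:*_; con)
  expand : ∀ w x y → w ℤ.* (x ℤ.- y) ≡ w ℤ.* x ℤ.+ -1ℤ ℤ.* (w ℤ.* y)
  expand = solve 3 (λ w x y → w :* (x :- y) := w :* x :+ con -1ℤ :* (w :* y)) refl

dot-sub : ∀ {d} (v w z : Fin d → ℤ) → dot (λ j → v j ℤ.- w j) z ≡ dot v z ℤ.- dot w z
dot-sub v w z = trans (sum-cong-≗ λ j → ℤₚ.*-comm (v j ℤ.- w j) (z j))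
  (trans (dot-minus z v w) (cong₂ ℤ._-_ (sum-cong-≗ λ j → ℤₚ.*-comm (z j) (v j)) (sum-cong-≗ λ j → ℤₚ.*-comm (z j) (w j))))

∣2*i∣≤1⇒i≡0 : ∀ i → ∣ + 2 ℤ.* i ∣ ℕ.≤ 1 → i ≡ 0ℤ
∣2*i∣≤1⇒i≡0 i le with ∣ i ∣ in eq | subst (ℕ._≤ 1) (ℤₚ.abs-* (+ 2) i) le
... | zero  | _ = ℤₚ.∣i∣≡0⇒i≡0 eq
... | suc m | le′ with ℕₚ.≤-trans (ℕₚ.*-monoʳ-≤ 2 (s≤s (z≤n {m}))) le′
...   | s≤s ()

-- For equal signs the sum, for opposite signs the difference has absolute value `∣ i ∣ + ∣ j ∣`,
-- which is at least 2.
sum-and-difference : ∀ i j → i ≢ 0ℤ → j ≢ 0ℤ → ∣ i ℤ.+ j ∣ ℕ.≤ 1 → ¬ (∣ i ℤ.- j ∣ ℕ.≤ 1)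
sum-and-difference (+ 0)       j           i≢0 _   _ _ = i≢0 refl
sum-and-difference i           (+ 0)       _   j≢0 _ _ = j≢0 refl
sum-and-difference (+ suc a)   (+ suc b)   _ _ (s≤s le) _ = ℕₚ.m+1+n≢0 a (ℕₚ.n≤0⇒n≡0 le)
sum-and-difference (+ suc a)   (-[1+ b ])  _ _ _ (s≤s le) = ℕₚ.m+1+n≢0 a (ℕₚ.n≤0⇒n≡0 le)
sum-and-difference (-[1+ a ])  (+ suc b)   _ _ _ (s≤s ())
sum-and-difference (-[1+ a ])  (-[1+ b ])  _ _ (s≤s ()) _

-- Column indices of the recursive matrices `Aₜ` below, one constructor per column block. Rows are
-- indexed by `Vec Bool t`, and so are the columns of the identity block.
data Col : ℕ → Set where
  leaf       : Col 0
  left right : ∀ {t} → Col t → Col (suc t)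
  diag       : ∀ {t} → Vec Bool t → Col (suc t)

⟦_⟧ : Bool → ℤ
⟦ true ⟧  = 1ℤ
⟦ false ⟧ = 0ℤ

sgn : Bool → ℤ
sgn true  = -1ℤ
sgn false = 1ℤ

-- The positive (s = true) and the negative (s = false) part of the matrices
-- A₀ = (1),  Aₜ₊₁ = [ Aₜ  Aₜ  I ; Aₜ  -Aₜ  0 ].
bit : ∀ {t} → Bool → Vec Bool t → Col t → Bool
bit s []          leaf      = s
bit s (false ∷ β) (left c)  = bit s β c
bit s (false ∷ β) (right c) = bit s β c
bit s (false ∷ β) (diag γ)  = s ∧ does (≡-dec Boolₚ._≟_ γ β)
bit s (true ∷ β)  (left c)  = bit s β c
bit s (true ∷ β)  (right c) = bit (not s) β c
bit s (true ∷ β)  (diag γ)  = false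

entry : ∀ {t} → Vec Bool t → Col t → ℤ
entry β c = ⟦ bit true β c ⟧ ℤ.- ⟦ bit false β c ⟧

-- A coordinate outside the block under consideration is sent to `nothing`; the default 0 removes it
-- from the linear form.
on : ∀ {A : Set} → (A → ℤ) → Maybe A → ℤ
on f = maybe f 0ℤ

fromLeft fromRight : ∀ {t} → Maybe (Col (suc t)) → Maybe (Col t)
fromLeft nothing          = nothing
fromLeft (just (left c))  = just c
fromLeft (just (right c)) = nothing
fromLeft (just (diag γ))  = nothing
fromRight nothing          = nothing
fromRight (just (left c))  = nothing
fromRight (just (right c)) = just c
fromRight (just (diag γ))  = nothing

isDiag : ∀ {t} → Vec Bool t → Maybe (Col (suc t)) → ℤ
isDiag β nothing          = 0ℤ
isDiag β (just (left c))  = 0ℤ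
isDiag β (just (right c)) = 0ℤ
isDiag β (just (diag γ))  = ⟦ does (≡-dec Boolₚ._≟_ γ β) ⟧

isDiag-self : ∀ {t} (β : Vec Bool t) → isDiag β (just (diag β)) ≡ 1ℤ
isDiag-self β = cong ⟦_⟧ (Dec.dec-true (≡-dec Boolₚ._≟_ β β) refl)

isDiag-support : ∀ {t} (β : Vec Bool t) m → isDiag β m ≢ 0ℤ → m ≡ just (diag β)
isDiag-support β nothing          ≢0 = contradiction refl ≢0
isDiag-support β (just (left c))  ≢0 = contradiction refl ≢0
isDiag-support β (just (right c)) ≢0 = contradiction refl ≢0
isDiag-support β (just (diag γ))  ≢0 with ≡-dec Boolₚ._≟_ γ β
... | yes refl = refl
... | no _     = contradiction refl ≢0

∣⟦⟧∣≤1 : ∀ b → ∣ ⟦ b ⟧ ∣ ℕ.≤ 1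
∣⟦⟧∣≤1 true  = s≤s z≤n
∣⟦⟧∣≤1 false = z≤n

∣isDiag∣≤1 : ∀ {t} (β : Vec Bool t) m → ∣ isDiag β m ∣ ℕ.≤ 1
∣isDiag∣≤1 β nothing          = z≤n
∣isDiag∣≤1 β (just (left c))  = z≤n
∣isDiag∣≤1 β (just (right c)) = z≤n
∣isDiag∣≤1 β (just (diag γ))  = ∣⟦⟧∣≤1 (does (≡-dec Boolₚ._≟_ γ β))

upper-row : ∀ {t} (β : Vec Bool t) m →
  on (entry (false ∷ β)) m ≡ on (entry β) (fromLeft m) ℤ.+ on (entry β) (fromRight m) ℤ.+ isDiag β m
upper-row β nothing          = refl
upper-row β (just (left c))  = sym (trans (ℤₚ.+-identityʳ _) (ℤₚ.+-identityʳ _))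
upper-row β (just (right c)) = sym (trans (ℤₚ.+-identityʳ _) (ℤₚ.+-identityˡ _))
upper-row β (just (diag γ))  = trans (ℤₚ.+-identityʳ δ) (sym (ℤₚ.+-identityˡ δ))
  where δ = ⟦ does (≡-dec Boolₚ._≟_ γ β) ⟧

lower-row : ∀ {t} (β : Vec Bool t) m →
  on (entry (true ∷ β)) m ≡ on (entry β) (fromLeft m) ℤ.- on (entry β) (fromRight m)
lower-row β nothing          = refl
lower-row β (just (left c))  = sym (ℤₚ.+-identityʳ _)
lower-row β (just (right c)) = solve 2 (λ x y → x :- y := con 0ℤ :- (y :- x)) refl ⟦ bit false β c ⟧ ⟦ bit true β c ⟧
  where open +-*-Solver using (solve; _:=_; _:+_; _:-_; _:*_; con)
lower-row β (just (diag γ))  = refl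

∣i*j∣≤1 : ∀ i j → ∣ i ∣ ℕ.≤ 1 → ∣ j ∣ ℕ.≤ 1 → ∣ i ℤ.* j ∣ ℕ.≤ 1
∣i*j∣≤1 i j i≤1 j≤1 = subst (ℕ._≤ 1) (sym (ℤₚ.abs-* i j)) (ℕₚ.*-mono-≤ i≤1 j≤1)

*≢0⇒ˡ≢0 : ∀ i j → i ℤ.* j ≢ 0ℤ → i ≢ 0ℤ
*≢0⇒ˡ≢0 i j ij≢0 refl = ij≢0 (ℤₚ.*-zeroˡ j)

Injectiveₘ : ∀ {A : Set} {d} → (Fin d → Maybe A) → Set
Injectiveₘ κ = ∀ {i j c} → κ i ≡ just c → κ j ≡ just c → i ≡ j

fromLeft-just : ∀ {t} (m : Maybe (Col (suc t))) {c} → fromLeft m ≡ just c → m ≡ just (left c)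
fromLeft-just (just (left c)) refl = refl

fromRight-just : ∀ {t} (m : Maybe (Col (suc t))) {c} → fromRight m ≡ just c → m ≡ just (right c)
fromRight-just (just (right c)) refl = refl

-- Induction along the block form of the matrix. `A`, `B`, `C` are the contributions of the left,
-- right and identity columns; the two row blocks give `A + B + C = 0` and `A = B`. By injectivity
-- of `κ`, `C β` has at most one nonzero term, and a parity argument makes all three vanish. The
-- induction hypothesis handles left and right columns, and `C` reads off the remaining entries of
-- `z`.
detect : ∀ t {d} (κ : Fin d → Maybe (Col t)) (z : Fin d → ℤ) → (∀ j → ∣ z j ∣ ℕ.≤ 1) → Injectiveₘ κ →
         (∀ β → dot (on (entry β) ∘ κ) z ≡ 0ℤ) → ∀ {j c} → κ j ≡ just c → z j ≡ 0ℤ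
detect zero κ z z≤1 inj ⊥z {j} {leaf} κj = begin
  z j                             ≡⟨ ℤₚ.*-identityˡ (z j) ⟨
  1ℤ ℤ.* z j                        ≡⟨ cong (λ m → on (entry []) m ℤ.* z j) κj ⟨
  on (entry []) (κ j) ℤ.* z j       ≡⟨ sum-single _ j (λ i i≢j → cong (ℤ._* z i) (off i i≢j)) ⟨
  dot (on (entry []) ∘ κ) z       ≡⟨ ⊥z [] ⟩
  0ℤ                              ∎
  where
  open ≡-Reasoning
  off : ∀ i → i ≢ j → on (entry []) (κ i) ≡ 0ℤ
  off i i≢j with κ i in κi
  ... | nothing   = refl
  ... | just leaf = contradiction (inj κi κj) i≢j
detect (suc t) κ z z≤1 inj ⊥z = conclude
  where
  open +-*-Solver using (solve; _:=_; _:+_; _:-_; _:*_; con)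
  A B C : Vec Bool t → ℤ
  A β = dot (on (entry β) ∘ fromLeft ∘ κ) z
  B β = dot (on (entry β) ∘ fromRight ∘ κ) z
  C β = dot (isDiag β ∘ κ) z

  A+B+C : ∀ β → A β ℤ.+ B β ℤ.+ C β ≡ 0ℤ
  A+B+C β = trans (sym (trans (dot-cong z (upper-row β ∘ κ)) (trans
    (dot-+ (λ j → on (entry β) (fromLeft (κ j)) ℤ.+ on (entry β) (fromRight (κ j))) (isDiag β ∘ κ) z)
    (cong (ℤ._+ C β) (dot-+ (on (entry β) ∘ fromLeft ∘ κ) (on (entry β) ∘ fromRight ∘ κ) z))))) (⊥z (false ∷ β))

  A-B : ∀ β → A β ℤ.- B β ≡ 0ℤ
  A-B β = trans (sym (trans (dot-cong z (lower-row β ∘ κ))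
    (dot-sub (on (entry β) ∘ fromLeft ∘ κ) (on (entry β) ∘ fromRight ∘ κ) z))) (⊥z (true ∷ β))

  ∣C∣≤1 : ∀ β → ∣ C β ∣ ℕ.≤ 1
  ∣C∣≤1 β = sum-atMostOne _
    (λ {i} {j} i≢0 j≢0 → inj (support i i≢0) (support j j≢0))
    (λ j → ∣i*j∣≤1 (isDiag β (κ j)) (z j) (∣isDiag∣≤1 β (κ j)) (z≤1 j))
    where
    support : ∀ j → isDiag β (κ j) ℤ.* z j ≢ 0ℤ → κ j ≡ just (diag β)
    support j ≢0 = isDiag-support β (κ j) (*≢0⇒ˡ≢0 _ (z j) ≢0)

  A≡B : ∀ β → A β ≡ B β
  A≡B β = ℤₚ.i-j≡0⇒i≡j (A β) (B β) (A-B β)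

  -- C = -2A is even and |C| ≤ 1.
  A≡0 : ∀ β → A β ≡ 0ℤ
  A≡0 β = ∣2*i∣≤1⇒i≡0 (A β) (subst (ℕ._≤ 1) (trans (cong ∣_∣ C≡-2A) (ℤₚ.∣-i∣≡∣i∣ (+ 2 ℤ.* A β))) (∣C∣≤1 β))
    where
    C≡-2A : C β ≡ ℤ.- (+ 2 ℤ.* A β)
    C≡-2A = trans (solve 2 (λ a c → c := (a :+ a :+ c) :- con (+ 2) :* a) refl (A β) (C β))
      (trans (cong (ℤ._- (+ 2 ℤ.* A β)) (trans (cong (λ b → A β ℤ.+ b ℤ.+ C β) (A≡B β)) (A+B+C β)))
             (ℤₚ.+-identityˡ (ℤ.- (+ 2 ℤ.* A β))))

  B≡0 : ∀ β → B β ≡ 0ℤ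
  B≡0 β = trans (sym (A≡B β)) (A≡0 β)

  C≡0 : ∀ β → C β ≡ 0ℤ
  C≡0 β = trans (sym (ℤₚ.+-identityˡ (C β)))
    (trans (cong (ℤ._+ C β) (sym (cong₂ ℤ._+_ (A≡0 β) (B≡0 β)))) (A+B+C β))

  conclude : ∀ {j c} → κ j ≡ just c → z j ≡ 0ℤ
  conclude {j} {left c} κj = detect t (fromLeft ∘ κ) z z≤1
    (λ {i} {j} κi κj → inj (fromLeft-just (κ i) κi) (fromLeft-just (κ j) κj)) A≡0 {c = c} (cong fromLeft κj)
  conclude {j} {right c} κj = detect t (fromRight ∘ κ) z z≤1
    (λ {i} {j} κi κj → inj (fromRight-just (κ i) κi) (fromRight-just (κ j) κj)) B≡0 {c = c} (cong fromRight κj)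
  conclude {j} {diag γ} κj = begin
    z j                      ≡⟨ ℤₚ.*-identityˡ (z j) ⟨
    1ℤ ℤ.* z j                 ≡⟨ cong (ℤ._* z j) (trans (cong (isDiag γ) κj) (isDiag-self γ)) ⟨
    isDiag γ (κ j) ℤ.* z j     ≡⟨ sum-single _ j off ⟨
    C γ                      ≡⟨ C≡0 γ ⟩
    0ℤ                       ∎
    where
    open ≡-Reasoning
    off : ∀ i → i ≢ j → isDiag γ (κ i) ℤ.* z i ≡ 0ℤ
    off i i≢j = decidable-stable (_ ℤₚ.≟ 0ℤ) λ ≢0 →
      i≢j (inj (isDiag-support γ (κ i) (*≢0⇒ˡ≢0 _ (z i) ≢0)) κj)

-- The ±1 rows 1 - 2β replace the 0/1 rows β: on a block with sum zero they
-- take even values, so that being bounded by 1 forces them to vanish.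
block-detect : ∀ t {d} (κ : Fin d → Maybe (Col t)) (z : Fin d → ℤ) → (∀ j → ∣ z j ∣ ℕ.≤ 1) → Injectiveₘ κ →
               dot (on (const 1ℤ) ∘ κ) z ≡ 0ℤ → (∀ s β → ∣ dot (on (sgn ∘ bit s β) ∘ κ) z ∣ ℕ.≤ 1) →
               ∀ {j c} → κ j ≡ just c → z j ≡ 0ℤ
block-detect t κ z z≤1 inj Σz≡0 small = detect t κ z z≤1 inj λ β →
  trans (dot-cong z (λ j → split β (κ j)))
 (trans (dot-sub (on (⟦_⟧ ∘ bit true β) ∘ κ) (on (⟦_⟧ ∘ bit false β) ∘ κ) z)
        (cong₂ ℤ._-_ (vanish true β) (vanish false β)))
  where
  split : ∀ β m → on (entry β) m ≡ on (⟦_⟧ ∘ bit true β) m ℤ.- on (⟦_⟧ ∘ bit false β) m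
  split β nothing  = refl
  split β (just c) = refl

  sgn≡ : ∀ (s : Bool) (β : Vec Bool t) m →
         on (sgn ∘ bit s β) m ≡ on (const 1ℤ) m ℤ.- + 2 ℤ.* on (⟦_⟧ ∘ bit s β) m
  sgn≡ s β nothing  = refl
  sgn≡ s β (just c) with bit s β c
  ... | true  = refl
  ... | false = refl

  vanish : ∀ s β → dot (on (⟦_⟧ ∘ bit s β) ∘ κ) z ≡ 0ℤ
  vanish s β = ∣2*i∣≤1⇒i≡0 M (subst (ℕ._≤ 1) eq (small s β))
    where
    M = dot (on (⟦_⟧ ∘ bit s β) ∘ κ) z
    eq : ∣ dot (on (sgn ∘ bit s β) ∘ κ) z ∣ ≡ ∣ + 2 ℤ.* M ∣
    eq = trans (cong ∣_∣ (trans (dot-cong z (sgn≡ s β ∘ κ))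
         (trans (dot-sub (on (const 1ℤ) ∘ κ) (λ j → + 2 ℤ.* on (⟦_⟧ ∘ bit s β) (κ j)) z)
         (trans (cong₂ ℤ._-_ Σz≡0 (dot-* (+ 2) (on (⟦_⟧ ∘ bit s β) ∘ κ) z)) (ℤₚ.+-identityˡ (ℤ.- (+ 2 ℤ.* M)))))))
         (ℤₚ.∣-i∣≡∣i∣ (+ 2 ℤ.* M))

-- Detecting a single nonzero block

Row : ℕ → ℕ → Set
Row r t = (Fin r × Bool × Vec Bool t) ⊎ (Fin r × Fin r × Bool)

module Blocks {d r t} (h : Fin d → Fin r) (κ : Fin d → Col t)
              (inj : ∀ {i j} → h i ≡ h j → κ i ≡ κ j → i ≡ j) where

  restrict : Fin r → Fin d → Maybe (Col t)
  restrict i j with h j Finₚ.≟ i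
  ... | yes _ = just (κ j)
  ... | no  _ = nothing

  restrict-just : ∀ i j {c} → restrict i j ≡ just c → h j ≡ i × κ j ≡ c
  restrict-just i j eq with h j Finₚ.≟ i
  restrict-just i j refl | yes hj = hj , refl

  restrict-self : ∀ j → restrict (h j) j ≡ just (κ j)
  restrict-self j with h j Finₚ.≟ h j
  ... | yes _ = refl
  ... | no ≢  = contradiction refl ≢

  restrict-injective : ∀ i → Injectiveₘ (restrict i)
  restrict-injective i {a} {b} eqa eqb with restrict-just i a eqa | restrict-just i b eqb
  ... | ha , κa | hb , κb = inj (trans ha (sym hb)) (trans κa (sym κb))

  -- The first kind of row is a detecting row with entries ±1 on block `i`; the second is the sum of
  -- block `i` plus or minus the sum of block `i′`.
  weight : Row r t → Fin d → ℤ
  weight (inj₁ (i , s , β)) j = on (sgn ∘ bit s β) (restrict i j)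
  weight (inj₂ (i , i′ , s)) j with h j Finₚ.≟ i | h j Finₚ.≟ i′
  ... | yes _ | _     = 1ℤ
  ... | no _  | yes _ = sgn s
  ... | no _  | no _  = 0ℤ

  ∣sgn∣≤1 : ∀ s → ∣ sgn s ∣ ℕ.≤ 1
  ∣sgn∣≤1 true  = s≤s z≤n
  ∣sgn∣≤1 false = s≤s z≤n

  ∣weight∣≤1 : ∀ ρ j → ∣ weight ρ j ∣ ℕ.≤ 1
  ∣weight∣≤1 (inj₁ (i , s , β)) j with restrict i j
  ... | just c  = ∣sgn∣≤1 (bit s β c)
  ... | nothing = z≤n
  ∣weight∣≤1 (inj₂ (i , i′ , s)) j with h j Finₚ.≟ i | h j Finₚ.≟ i′
  ... | yes _ | _     = s≤s z≤n
  ... | no _  | yes _ = ∣sgn∣≤1 s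
  ... | no _  | no _  = z≤n

  pair-weight : ∀ {i i′} → i ≢ i′ → ∀ s j → weight (inj₂ (i , i′ , s)) j ≡
                on (const 1ℤ) (restrict i j) ℤ.+ sgn s ℤ.* on (const 1ℤ) (restrict i′ j)
  pair-weight {i} {i′} i≢i′ s j with h j Finₚ.≟ i | h j Finₚ.≟ i′
  ... | yes refl | yes refl = contradiction refl i≢i′
  ... | yes _    | no _  = sym (cong (λ s → 1ℤ ℤ.+ s) (ℤₚ.*-zeroʳ (sgn s)))
  ... | no _     | yes _ = sym (trans (ℤₚ.+-identityˡ _) (ℤₚ.*-identityʳ (sgn s)))
  ... | no _     | no _  = sym (trans (ℤₚ.+-identityˡ _) (ℤₚ.*-zeroʳ (sgn s)))

  -- A block where `z` does not vanish has nonzero sum `u`, by `block-detect`. Two such blocks would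
  -- have both the sum and the difference of their `u` bounded by 1, against `sum-and-difference`.
  one-block : (z : Fin d → ℤ) → (∀ j → ∣ z j ∣ ℕ.≤ 1) → (∀ ρ → ∣ dot (weight ρ) z ∣ ℕ.≤ 1) →
              ∀ {i j} → z i ≢ 0ℤ → z j ≢ 0ℤ → h i ≡ h j
  one-block z z≤1 small {i} {j} zi≢0 zj≢0 = decidable-stable (h i Finₚ.≟ h j) λ hi≢hj →
    sum-and-difference (u (h i)) (u (h j)) (u≢0 i zi≢0) (u≢0 j zj≢0)
      (subst (λ s → ∣ s ∣ ℕ.≤ 1) (trans (pair hi≢hj false) (cong (λ s → u (h i) ℤ.+ s) (ℤₚ.*-identityˡ (u (h j)))))
             (small (inj₂ (h i , h j , false))))
      (subst (λ s → ∣ s ∣ ℕ.≤ 1) (trans (pair hi≢hj true) (cong (λ s → u (h i) ℤ.+ s) (ℤₚ.-1*i≡-i (u (h j)))))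
             (small (inj₂ (h i , h j , true))))
    where
    u : Fin r → ℤ
    u b = dot (on (const 1ℤ) ∘ restrict b) z

    u≢0 : ∀ j → z j ≢ 0ℤ → u (h j) ≢ 0ℤ
    u≢0 j zj≢0 u≡0 = zj≢0 (block-detect t (restrict (h j)) z z≤1 (restrict-injective (h j)) u≡0
      (λ s β → small (inj₁ (h j , s , β))) (restrict-self j))

    pair : ∀ {b b′} → b ≢ b′ → ∀ s → dot (weight (inj₂ (b , b′ , s))) z ≡ u b ℤ.+ sgn s ℤ.* u b′
    pair {b} {b′} b≢b′ s = trans (dot-cong z (pair-weight b≢b′ s))
      (trans (dot-+ (on (const 1ℤ) ∘ restrict b) (λ j → sgn s ℤ.* on (const 1ℤ) (restrict b′ j)) z)
             (cong (λ x → u b ℤ.+ x) (dot-* (sgn s) (on (const 1ℤ) ∘ restrict b′) z)))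

-- Linear representations

toℚᵘ-/1 : ∀ i → toℚᵘ (i / 1) ℚᵘ.≃ mkℚᵘ i 0
toℚᵘ-/1 i = ℚₚ.toℚᵘ-fromℚᵘ (mkℚᵘ i 0)

/1-≤ : ∀ {i j} → i ℤ.≤ j ⇔ i / 1 ℚ.≤ j / 1
/1-≤ {i} {j} = mk⇔
  (λ i≤j → ℚₚ.toℚᵘ-cancel-≤ (ℚᵘₚ.≤-respˡ-≃ (ℚᵘₚ.≃-sym (toℚᵘ-/1 i)) (ℚᵘₚ.≤-respʳ-≃ (ℚᵘₚ.≃-sym (toℚᵘ-/1 j))
             (*≤* (ℤₚ.*-monoʳ-≤-nonNeg 1ℤ i≤j)))))
  (λ le → subst₂ ℤ._≤_ (ℤₚ.*-identityʳ i) (ℤₚ.*-identityʳ j) (ℚᵘₚ.drop-*≤*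
             (ℚᵘₚ.≤-respˡ-≃ (toℚᵘ-/1 i) (ℚᵘₚ.≤-respʳ-≃ (toℚᵘ-/1 j) (ℚₚ.toℚᵘ-mono-≤ le)))))

/1-+ : ∀ i j → (i ℤ.+ j) / 1 ≡ i / 1 ℚ.+ j / 1
/1-+ i j = ℚₚ.toℚᵘ-injective (ℚᵘₚ.≃-trans (toℚᵘ-/1 (i ℤ.+ j)) (ℚᵘₚ.≃-sym
  (ℚᵘₚ.≃-trans (ℚₚ.toℚᵘ-homo-+ (i / 1) (j / 1))
  (ℚᵘₚ.≃-trans (ℚᵘₚ.+-cong (toℚᵘ-/1 i) (toℚᵘ-/1 j))
               (*≡* (cong (ℤ._* 1ℤ) (cong₂ ℤ._+_ (ℤₚ.*-identityʳ i) (ℤₚ.*-identityʳ j))))))))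

∣i∣≤1 : ∀ i → ∣ i ∣ ℕ.≤ 1 ⇔ (i ℤ.≤ 1ℤ × ℤ.- i ℤ.≤ 1ℤ)
∣i∣≤1 (+ zero)  = mk⇔ (λ _ → ℤ.+≤+ z≤n , ℤ.+≤+ z≤n) (λ _ → z≤n)
∣i∣≤1 (+ suc n) = mk⇔ (λ n≤1 → ℤ.+≤+ n≤1 , ℤ.-≤+) (λ (n≤1 , _) → ℤₚ.drop‿+≤+ n≤1)
∣i∣≤1 (-[1+ n ]) = mk⇔ (λ n≤1 → ℤ.-≤+ , ℤ.+≤+ n≤1) (λ (_ , n≤1) → ℤₚ.drop‿+≤+ n≤1)

i-j≤1 : ∀ i j → i ℤ.- j ℤ.≤ 1ℤ ⇔ i ℤ.≤ j ℤ.+ 1ℤ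
i-j≤1 i j = mk⇔
  (λ le → subst₂ ℤ._≤_ (solve 2 (λ i j → j :+ (i :- j) := i) refl i j) refl (ℤₚ.+-monoʳ-≤ j le))
  (λ le → subst₂ ℤ._≤_ (ℤₚ.+-comm (ℤ.- j) i) (solve 1 (λ j → :- j :+ (j :+ con 1ℤ) := con 1ℤ) refl j)
                       (ℤₚ.+-monoʳ-≤ (ℤ.- j) le))
  where open +-*-Solver using (solve; _:=_; _:+_; _:-_; :-_; con)

/1-≤+1 : ∀ i j → i ℤ.- j ℤ.≤ 1ℤ ⇔ i / 1 ℚ.≤ j / 1 ℚ.+ 1ℚ
/1-≤+1 i j = mk⇔
  (λ le → subst (i / 1 ℚ.≤_) (/1-+ j 1ℤ) (Equivalence.to /1-≤ (Equivalence.to (i-j≤1 i j) le)))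
  (λ le → Equivalence.from (i-j≤1 i j) (Equivalence.from /1-≤ (subst (i / 1 ℚ.≤_) (sym (/1-+ j 1ℤ)) le)))

near-/1 : ∀ i j → ∣ i ℤ.- j ∣ ℕ.≤ 1 ⇔ Near (i / 1) (j / 1)
near-/1 i j = mk⇔
  (λ le → let (a , b) = Equivalence.to (∣i∣≤1 (i ℤ.- j)) le in
    Equivalence.to (/1-≤+1 j i) (subst (ℤ._≤ 1ℤ) -[i-j] b) , Equivalence.to (/1-≤+1 i j) a)
  (λ (a , b) → Equivalence.from (∣i∣≤1 (i ℤ.- j))
    (Equivalence.from (/1-≤+1 i j) b , subst (ℤ._≤ 1ℤ) (sym -[i-j]) (Equivalence.from (/1-≤+1 j i) a)))
  where
  -[i-j] : ℤ.- (i ℤ.- j) ≡ j ℤ.- i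
  -[i-j] = solve 2 (λ i j → :- (i :- j) := j :- i) refl i j
    where open +-*-Solver using (solve; _:=_; _:-_; :-_)

-- For adjacent words the difference `z` has a single nonzero entry, so each form changes by at most
-- 1. Conversely, if all forms are near, `z` has at most one nonzero entry, and distinct words
-- provide one.
linear-representation : ∀ {d k} (w : Fin k → Fin d → ℤ) → (∀ ρ j → ∣ w ρ j ∣ ℕ.≤ 1) →
  (∀ z → (∀ j → ∣ z j ∣ ℕ.≤ 1) → (∀ ρ → ∣ dot (w ρ) z ∣ ℕ.≤ 1) → AtMostOne z) →
  RationallyRepresentable (H d) k
linear-representation {d} {k} w w≤1 separates = (λ u ρ → dot (w ρ) (bits u) / 1) , adj⇔near
  where
  bits : Vec Bool d → Fin d → ℤ
  bits u j = ⟦ lookup u j ⟧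

  ∣⟦⟧-⟦⟧∣≤1 : ∀ a b → ∣ ⟦ a ⟧ ℤ.- ⟦ b ⟧ ∣ ℕ.≤ 1
  ∣⟦⟧-⟦⟧∣≤1 true  true  = z≤n
  ∣⟦⟧-⟦⟧∣≤1 true  false = s≤s z≤n
  ∣⟦⟧-⟦⟧∣≤1 false true  = s≤s z≤n
  ∣⟦⟧-⟦⟧∣≤1 false false = z≤n

  ≢⇒⟦⟧-⟦⟧≢0 : ∀ {a b} → a ≢ b → ⟦ a ⟧ ℤ.- ⟦ b ⟧ ≢ 0ℤ
  ≢⇒⟦⟧-⟦⟧≢0 {true}  {true}  a≢b _ = a≢b refl
  ≢⇒⟦⟧-⟦⟧≢0 {false} {false} a≢b _ = a≢b refl

  module _ (u v : Vec Bool d) where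
    z : Fin d → ℤ
    z j = bits u j ℤ.- bits v j

    z≤1 : ∀ j → ∣ z j ∣ ℕ.≤ 1
    z≤1 j = ∣⟦⟧-⟦⟧∣≤1 (lookup u j) (lookup v j)

    near⇔ : ∀ ρ → ∣ dot (w ρ) z ∣ ℕ.≤ 1 ⇔ Near (dot (w ρ) (bits u) / 1) (dot (w ρ) (bits v) / 1)
    near⇔ ρ = subst (λ s → ∣ s ∣ ℕ.≤ 1 ⇔ Near (dot (w ρ) (bits u) / 1) (dot (w ρ) (bits v) / 1))
                    (sym (dot-minus (w ρ) (bits u) (bits v))) (near-/1 (dot (w ρ) (bits u)) (dot (w ρ) (bits v)))

    adjacent⇒small : Adj (H d) u v → ∀ ρ → ∣ dot (w ρ) z ∣ ℕ.≤ 1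
    adjacent⇒small (i , _ , uniq) ρ = subst (λ s → ∣ s ∣ ℕ.≤ 1) (sym (sum-single _ i off))
                                            (∣i*j∣≤1 (w ρ i) (z i) (w≤1 ρ i) (z≤1 i))
      where
      off : ∀ j → j ≢ i → w ρ j ℤ.* z j ≡ 0ℤ
      off j j≢i with lookup u j Boolₚ.≟ lookup v j
      ... | yes eq = trans (cong (λ b → w ρ j ℤ.* (⟦ b ⟧ ℤ.- ⟦ lookup v j ⟧)) eq)
                    (trans (cong (w ρ j ℤ.*_) (ℤₚ.+-inverseʳ ⟦ lookup v j ⟧)) (ℤₚ.*-zeroʳ (w ρ j)))
      ... | no neq = contradiction (sym (uniq neq)) j≢i

    small⇒adjacent : u ≢ v → (∀ ρ → ∣ dot (w ρ) z ∣ ℕ.≤ 1) → Adj (H d) u v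
    small⇒adjacent u≢v small with any? (λ i → ¬? (lookup u i Boolₚ.≟ lookup v i))
    ... | yes (i , neq) = i , neq , λ neq′ → separates z z≤1 small (≢⇒⟦⟧-⟦⟧≢0 neq) (≢⇒⟦⟧-⟦⟧≢0 neq′)
    ... | no ∄ = contradiction (lookup-ext λ i → decidable-stable (lookup u i Boolₚ.≟ lookup v i) λ neq → ∄ (i , neq)) u≢v

  adj⇔near : ∀ u v → u ≢ v → Adj (H d) u v ⇔ (∀ ρ → Near (dot (w ρ) (bits u) / 1) (dot (w ρ) (bits v) / 1))
  adj⇔near u v u≢v = mk⇔
    (λ adj ρ → Equivalence.to (near⇔ u v ρ) (adjacent⇒small u v adj ρ))
    (λ near → small⇒adjacent u v u≢v λ ρ → Equivalence.from (near⇔ u v ρ) (near ρ))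

-- The three slicings of a grid

size : ℕ → ℕ
size zero    = 1
size (suc t) = size t ℕ.+ (size t ℕ.+ 2 ^ t)

Fin↔Bits : ∀ t → Fin (2 ^ t) ↔ Vec Bool t
Fin↔Bits t = ↔-sym (proj₂ (finite (H t)))

Fin↔Col : ∀ t → Fin (size t) ↔ Col t
Fin↔Col zero    = mk↔ₛ′ (λ _ → leaf) (λ _ → tt) (λ { leaf → refl }) (λ _ → refl) ↔-∘ 1↔⊤
Fin↔Col (suc t) = build ↔-∘ ((Fin↔Col t ⊎-↔ ((Fin↔Col t ⊎-↔ Fin↔Bits t) ↔-∘ +↔⊎)) ↔-∘ +↔⊎)
  where
  build : (Col t ⊎ (Col t ⊎ Vec Bool t)) ↔ Col (suc t)
  build = mk↔ₛ′
    (λ { (inj₁ c) → left c ; (inj₂ (inj₁ c)) → right c ; (inj₂ (inj₂ γ)) → diag γ })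
    (λ { (left c) → inj₁ c ; (right c) → inj₂ (inj₁ c) ; (diag γ) → inj₂ (inj₂ γ) })
    (λ { (left c) → refl ; (right c) → refl ; (diag γ) → refl })
    (λ { (inj₁ c) → refl ; (inj₂ (inj₁ c)) → refl ; (inj₂ (inj₂ γ)) → refl })

rows : ℕ → ℕ → ℕ
rows r t = r ℕ.* (2 ℕ.* 2 ^ t) ℕ.+ r ℕ.* (r ℕ.* 2)

Fin↔Row : ∀ r t → Fin (rows r t) ↔ Row r t
Fin↔Row r t = (((↔-id _ ×-↔ ((2↔Bool ×-↔ Fin↔Bits t) ↔-∘ *↔×)) ↔-∘ *↔×)
               ⊎-↔ ((↔-id _ ×-↔ ((↔-id _ ×-↔ 2↔Bool) ↔-∘ *↔×)) ↔-∘ *↔×)) ↔-∘ +↔⊎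

-- Slicing an r × r × r grid of coordinates along each axis gives three systems
-- of blocks, and a vector living in one slice of each lives at one point.
grid-representation : ∀ {d} r t → d ℕ.≤ r ℕ.* (r ℕ.* r) → r ℕ.* r ℕ.≤ size t →
                      RationallyRepresentable (H d) (3 ℕ.* rows r t)
grid-representation {d} r t d≤r³ r²≤size = linear-representation
  (weight ∘ row) (λ ρ → ∣weight∣≤1 (row ρ))
  λ z z≤1 small {i} {j} zi≢0 zj≢0 → grid-injective i j λ a →
    Blocks.one-block (h a) (κ a) (κ-injective a _ _) z z≤1
      (λ ρ → subst (λ σ → ∣ dot (weight σ) z ∣ ℕ.≤ 1) (row-index (a , ρ)) (small (index (a , ρ)))) zi≢0 zj≢0
  where
  point : Fin d → Fin (r ℕ.* (r ℕ.* r))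
  point j = inject≤ j d≤r³

  h : Fin 3 → Fin d → Fin r
  h 0F j = proj₁ (remQuot {r} (r ℕ.* r) (point j))
  h 1F j = proj₁ (remQuot {r} r (proj₂ (remQuot {r} (r ℕ.* r) (point j))))
  h 2F j = proj₂ (remQuot {r} r (proj₂ (remQuot {r} (r ℕ.* r) (point j))))

  grid-injective : ∀ i j → (∀ a → h a i ≡ h a j) → i ≡ j
  grid-injective i j eq = inject≤-injective d≤r³ d≤r³ i j
    (trans (sym (combine-remQuot {r} (r ℕ.* r) (point i)))
    (trans (cong₂ combine (eq 0F)
             (trans (sym (combine-remQuot {r} r _))
             (trans (cong₂ combine (eq 1F) (eq 2F)) (combine-remQuot {r} r _))))
           (combine-remQuot {r} (r ℕ.* r) (point j))))

  col : Fin r → Fin r → Col t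
  col a b = Inverse.to (Fin↔Col t) (inject≤ (combine a b) r²≤size)

  col-injective : ∀ a b a′ b′ → col a b ≡ col a′ b′ → a ≡ a′ × b ≡ b′
  col-injective a b a′ b′ eq = combine-injective a b a′ b′ (inject≤-injective r²≤size r²≤size _ _
    (trans (sym (strictlyInverseʳ _)) (trans (cong from eq) (strictlyInverseʳ _))))
    where open Inverse (Fin↔Col t)

  -- Within a slice along one axis the other two grid coordinates determine the point, so they name
  -- its column; `r²≤size` supplies enough columns.
  κ : Fin 3 → Fin d → Col t
  κ 0F j = col (h 1F j) (h 2F j)
  κ 1F j = col (h 0F j) (h 2F j)
  κ 2F j = col (h 0F j) (h 1F j)

  κ-injective : ∀ a i j → h a i ≡ h a j → κ a i ≡ κ a j → i ≡ j
  κ-injective 0F i j ha κa with col-injective _ _ _ _ κa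
  ... | h1 , h2 = grid-injective i j λ { 0F → ha ; 1F → h1 ; 2F → h2 }
  κ-injective 1F i j ha κa with col-injective _ _ _ _ κa
  ... | h0 , h2 = grid-injective i j λ { 0F → h0 ; 1F → ha ; 2F → h2 }
  κ-injective 2F i j ha κa with col-injective _ _ _ _ κa
  ... | h0 , h1 = grid-injective i j λ { 0F → h0 ; 1F → h1 ; 2F → ha }

  open Inverse ((↔-id (Fin 3) ×-↔ Fin↔Row r t) ↔-∘ *↔×) using ()
    renaming (to to row; from to index; strictlyInverseˡ to row-index)

  weight : Fin 3 × Row r t → Fin d → ℤ
  weight (a , ρ) = Blocks.weight (h a) (κ a) (κ-injective a _ _) ρ

  ∣weight∣≤1 : ∀ σ j → ∣ weight σ j ∣ ℕ.≤ 1
  ∣weight∣≤1 (a , ρ) = Blocks.∣weight∣≤1 (h a) (κ a) (κ-injective a _ _) ρ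

-- Choice of the grid and matrix sizes

open ℕₚ.≤-Reasoning
open ℕSolver.+-*-Solver using (solve; _:=_; _:+_; _:*_; con)

n<2^n : ∀ n → n ℕ.< 2 ^ n
n<2^n zero    = s≤s z≤n
n<2^n (suc n) = begin-strict
  suc n             <⟨ ℕₚ.+-mono-≤-< (ℕₚ.m^n>0 2 n) (n<2^n n) ⟩
  2 ^ n ℕ.+ 2 ^ n     ≡⟨ cong (λ x → 2 ^ n ℕ.+ x) (ℕₚ.+-identityʳ (2 ^ n)) ⟨
  2 ^ suc n         ∎

-- The surplus of columns over the `2 ^ t` rows is a factor `(t + 2) / 2`, the source of the
-- logarithmic saving.
2*size : ∀ t → 2 ℕ.* size t ≡ (2 ℕ.+ t) ℕ.* 2 ^ t
2*size zero    = refl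
2*size (suc t) = begin-equality
  2 ℕ.* (size t ℕ.+ (size t ℕ.+ 2 ^ t))      ≡⟨ solve 2 (λ s p → con 2 :* (s :+ (s :+ p)) := con 2 :* (con 2 :* s) :+ con 2 :* p) refl (size t) (2 ^ t) ⟩
  2 ℕ.* (2 ℕ.* size t) ℕ.+ 2 ℕ.* 2 ^ t         ≡⟨ cong (λ x → 2 ℕ.* x ℕ.+ 2 ℕ.* 2 ^ t) (2*size t) ⟩
  2 ℕ.* ((2 ℕ.+ t) ℕ.* 2 ^ t) ℕ.+ 2 ℕ.* 2 ^ t    ≡⟨ solve 2 (λ t p → con 2 :* ((con 2 :+ t) :* p) :+ con 2 :* p := (con 3 :+ t) :* (con 2 :* p)) refl t (2 ^ t) ⟩
  (3 ℕ.+ t) ℕ.* 2 ^ suc t                  ∎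

2^≤size : ∀ t → 2 ^ t ≤ size t
2^≤size t = ℕₚ.*-cancelˡ-≤ 2 (begin
  2 ℕ.* 2 ^ t         ≤⟨ ℕₚ.*-monoˡ-≤ (2 ^ t) (ℕₚ.m≤m+n 2 t) ⟩
  (2 ℕ.+ t) ℕ.* 2 ^ t   ≡⟨ 2*size t ⟨
  2 ℕ.* size t        ∎)

size≤4^ : ∀ t → size t ≤ 2 ^ t ℕ.* 2 ^ t
size≤4^ t = ℕₚ.*-cancelˡ-≤ 2 (begin
  2 ℕ.* size t                ≡⟨ 2*size t ⟩
  (2 ℕ.+ t) ℕ.* 2 ^ t           ≤⟨ ℕₚ.*-monoˡ-≤ (2 ^ t) (n<2^n (suc t)) ⟩
  2 ^ suc t ℕ.* 2 ^ t         ≡⟨ ℕₚ.*-assoc 2 (2 ^ t) (2 ^ t) ⟩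
  2 ℕ.* (2 ^ t ℕ.* 2 ^ t)       ∎)

-- Take the least `t` with enough columns. Since `size t ≤ 4 ^ t`, it is at least `m`; since `t - 1`
-- does not suffice, `(t + 1) * 2 ^ (t - 1)`, which is `2 * size (t - 1)`, is at most `2 * r²`.
columns : ∀ m → let r = 2 ^ m in ∃[ t ] r ℕ.* r ≤ size t × 2 ^ t ℕ.* m ≤ 4 ℕ.* (r ℕ.* r)
columns m with least (λ t → 2 ^ m ℕ.* 2 ^ m ℕₚ.≤? size t) {m ℕ.+ m} (ℕₚ.≤-trans (ℕₚ.≤-reflexive (sym (ℕₚ.^-distribˡ-+-* 2 m m))) (2^≤size (m ℕ.+ m)))
... | t , _ , r²≤size , minimal = t , r²≤size , bound t minimal m≤t
  where
  m≤t : m ≤ t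
  m≤t = ℕₚ.≮⇒≥ λ t<m → ℕₚ.<⇒≱ (ℕₚ.*-mono-< (ℕₚ.^-monoʳ-< 2 ℕₚ.≤-refl t<m) (ℕₚ.^-monoʳ-< 2 ℕₚ.≤-refl t<m)) (ℕₚ.≤-trans r²≤size (size≤4^ t))

  bound : ∀ t → (∀ j → 2 ^ m ℕ.* 2 ^ m ≤ size j → t ≤ j) → m ≤ t → 2 ^ t ℕ.* m ≤ 4 ℕ.* (2 ^ m ℕ.* 2 ^ m)
  bound zero    minimal z≤n = z≤n
  bound (suc t) minimal m≤t = begin
    2 ^ suc t ℕ.* m              ≤⟨ ℕₚ.*-monoʳ-≤ (2 ^ suc t) (ℕₚ.≤-trans m≤t (ℕₚ.n≤1+n (suc t))) ⟩
    2 ^ suc t ℕ.* (2 ℕ.+ t)        ≡⟨ solve 2 (λ p t → (con 2 :* p) :* (con 2 :+ t) := con 2 :* ((con 2 :+ t) :* p)) refl (2 ^ t) t ⟩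
    2 ℕ.* ((2 ℕ.+ t) ℕ.* 2 ^ t)      ≡⟨ cong (2 ℕ.*_) (2*size t) ⟨
    2 ℕ.* (2 ℕ.* size t)           ≤⟨ ℕₚ.*-monoʳ-≤ 2 (ℕₚ.*-monoʳ-≤ 2 (ℕₚ.≰⇒≥ λ le → ℕₚ.1+n≰n (minimal t le))) ⟩
    2 ℕ.* (2 ℕ.* (2 ^ m ℕ.* 2 ^ m))  ≡⟨ ℕₚ.*-assoc 2 2 (2 ^ m ℕ.* 2 ^ m) ⟨
    4 ℕ.* (2 ^ m ℕ.* 2 ^ m)        ∎

cube2^ : ℕ → ℕ
cube2^ m = 2 ^ m ℕ.* (2 ^ m ℕ.* 2 ^ m)

cube2^≡ : ∀ m → cube2^ m ≡ 2 ^ (3 ℕ.* m)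
cube2^≡ m = sym (begin-equality
  2 ^ (m ℕ.+ (m ℕ.+ (m ℕ.+ 0)))        ≡⟨ cong (λ x → 2 ^ (m ℕ.+ (m ℕ.+ x))) (ℕₚ.+-identityʳ m) ⟩
  2 ^ (m ℕ.+ (m ℕ.+ m))              ≡⟨ ℕₚ.^-distribˡ-+-* 2 m (m ℕ.+ m) ⟩
  2 ^ m ℕ.* 2 ^ (m ℕ.+ m)            ≡⟨ cong (2 ^ m ℕ.*_) (ℕₚ.^-distribˡ-+-* 2 m m) ⟩
  cube2^ m                       ∎)

-- The constant is 960 = 24 * 5 * 8. Here 24 = 3 * 2 * 4 comes from three axes, two signs and
-- `3m + 1 ≤ 4m`; 5 = 4 + 1 from `p * m ≤ 4 * r²` and `m ≤ r` for the two kinds of rows; and 8 from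
-- `r³ = 8y`.
rows-bound : ∀ {r p m y d} → 1 ≤ m → m ≤ r → p ℕ.* m ≤ 4 ℕ.* (r ℕ.* r) → r ℕ.* (r ℕ.* r) ≡ 8 ℕ.* y → y ≤ d →
             3 ℕ.* (r ℕ.* (2 ℕ.* p) ℕ.+ r ℕ.* (r ℕ.* 2)) ℕ.* suc (3 ℕ.* m) ≤ 960 ℕ.* d
rows-bound {r} {p} {m} {y} {d} 1≤m m≤r pm≤ r³≡8y y≤d = begin
  3 ℕ.* (r ℕ.* (2 ℕ.* p) ℕ.+ r ℕ.* (r ℕ.* 2)) ℕ.* suc (3 ℕ.* m)
    ≤⟨ ℕₚ.*-monoʳ-≤ (3 ℕ.* (r ℕ.* (2 ℕ.* p) ℕ.+ r ℕ.* (r ℕ.* 2))) (ℕₚ.+-monoˡ-≤ (3 ℕ.* m) 1≤m) ⟩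
  3 ℕ.* (r ℕ.* (2 ℕ.* p) ℕ.+ r ℕ.* (r ℕ.* 2)) ℕ.* (4 ℕ.* m)
    ≡⟨ solve 6 (λ a b c r p m → a :* (r :* (b :* p) :+ r :* (r :* b)) :* (c :* m) :=
                  a :* b :* c :* (r :* (p :* m) :+ r :* (r :* m))) refl 3 2 4 r p m ⟩
  24 ℕ.* (r ℕ.* (p ℕ.* m) ℕ.+ r ℕ.* (r ℕ.* m))
    ≤⟨ ℕₚ.*-monoʳ-≤ 24 (ℕₚ.+-mono-≤ (ℕₚ.*-monoʳ-≤ r pm≤) (ℕₚ.*-monoʳ-≤ r (ℕₚ.*-monoʳ-≤ r m≤r))) ⟩
  24 ℕ.* (r ℕ.* (4 ℕ.* (r ℕ.* r)) ℕ.+ r ℕ.* (r ℕ.* r))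
    ≡⟨ cong (24 ℕ.*_) (solve 2 (λ a r → r :* (a :* (r :* r)) :+ r :* (r :* r) := (con 1 :+ a) :* (r :* (r :* r))) refl 4 r) ⟩
  24 ℕ.* (5 ℕ.* (r ℕ.* (r ℕ.* r)))    ≡⟨ cong (λ x → 24 ℕ.* (5 ℕ.* x)) r³≡8y ⟩
  24 ℕ.* (5 ℕ.* (8 ℕ.* y))          ≡⟨ cong (24 ℕ.*_) (ℕₚ.*-assoc 5 8 y) ⟨
  24 ℕ.* (40 ℕ.* y)               ≡⟨ ℕₚ.*-assoc 24 40 y ⟨
  960 ℕ.* y                     ≤⟨ ℕₚ.*-monoʳ-≤ 960 y≤d ⟩
  960 ℕ.* d                     ∎

efficient-grid : ∀ {d r m y} t → 1 ≤ m → m ≤ r → d ≤ r ℕ.* (r ℕ.* r) → r ℕ.* r ≤ size t → 2 ^ t ℕ.* m ≤ 4 ℕ.* (r ℕ.* r) →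
                 r ℕ.* (r ℕ.* r) ≡ 8 ℕ.* y → y ≤ d →
                 ∃[ k ] k ℕ.* suc (3 ℕ.* m) ≤ 960 ℕ.* d × RationallyRepresentable (H d) k
efficient-grid {r = r} t 1≤m m≤r d≤r³ r²≤size 2^t*m≤ r³≡8y y≤d =
  3 ℕ.* rows r t , rows-bound {r} {2 ^ t} 1≤m m≤r 2^t*m≤ r³≡8y y≤d , grid-representation r t d≤r³ r²≤size

-- The side is `r = 2 ^ m` for the least `m` with `d ≤ r³`. Half that side is too small, so
-- `r³ ≤ 8d`, while `3m` bounds `log₂ d` from above. The successor in `suc (3m)` provides a strict
-- bound on the logarithm.
efficient-representation : ∀ d → 2 ≤ d →
  ∃[ m ] ∃[ k ] d ≤ 2 ^ (3 ℕ.* m) × k ℕ.* suc (3 ℕ.* m) ≤ 960 ℕ.* d × RationallyRepresentable (H d) k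
efficient-representation d 2≤d = fit (least (λ m → d ℕₚ.≤? cube2^ m) {d} d≤cube)
  where
  d≤cube : d ≤ cube2^ d
  d≤cube = begin
    d                  ≤⟨ ℕₚ.<⇒≤ (n<2^n d) ⟩
    2 ^ d              ≤⟨ ℕₚ.^-monoʳ-≤ 2 (ℕₚ.m≤m+n d (d ℕ.+ (d ℕ.+ 0))) ⟩
    2 ^ (3 ℕ.* d)        ≡⟨ cube2^≡ d ⟨
    cube2^ d           ∎

  doubled-cube : ∀ q → 2 ℕ.* q ℕ.* (2 ℕ.* q ℕ.* (2 ℕ.* q)) ≡ 8 ℕ.* (q ℕ.* (q ℕ.* q))
  doubled-cube = solve 2 (λ a q → (a :* q) :* ((a :* q) :* (a :* q)) := a :* a :* a :* (q :* (q :* q))) refl 2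

  fit : ∃[ m ] m ≤ d × d ≤ cube2^ m × (∀ j → d ≤ cube2^ j → m ≤ j) →
        ∃[ m ] ∃[ k ] d ≤ 2 ^ (3 ℕ.* m) × k ℕ.* suc (3 ℕ.* m) ≤ 960 ℕ.* d × RationallyRepresentable (H d) k
  fit (zero  , _ , d≤1 , _) = contradiction (ℕₚ.≤-trans 2≤d d≤1) λ { (s≤s ()) }
  fit (suc n , _ , d≤r³ , minimal) =
    let t , r²≤size , 2^t*m≤ = columns (suc n)
        k , few , rep = efficient-grid t (s≤s z≤n) (ℕₚ.<⇒≤ (n<2^n (suc n))) d≤r³ r²≤size 2^t*m≤
                          (doubled-cube (2 ^ n)) (ℕₚ.≰⇒≥ λ le → ℕₚ.1+n≰n (minimal n le))
    in suc n , k , subst (d ≤_) (cube2^≡ (suc n)) d≤r³ , few , rep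

-- Comparison with the real number d / log₂ d

2^-cancel-≤ : ∀ {a b} → 2 ^ a ≤ 2 ^ b → a ≤ b
2^-cancel-≤ le = ℕₚ.≮⇒≥ λ b<a → ℕₚ.<⇒≱ (ℕₚ.^-monoʳ-< 2 ℕₚ.≤-refl b<a) le

-- With `d = suc e ≥ 2`, `2d ≤ d²` gives `2 ^ e ≤ d ^ (2k)`. Raising to the power `q` and using that
-- `p / q` bounds `log₂ d` yields `e * q ≤ 2 * k * p`; the remaining factor 2 is `d ≤ 2e`.
exponent-bound : ∀ e {k} → 1 ≤ e → 2 ^ e ≤ (suc e ℕ.+ suc e) ^ k →
                 ∀ p q → suc e ^ q ≤ 2 ^ p → suc e ℕ.* q ≤ 4 ℕ.* k ℕ.* p
exponent-bound e {k} 1≤e few p q d^q≤2^p = begin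
  d ℕ.* q                    ≤⟨ ℕₚ.*-monoˡ-≤ q (ℕₚ.+-monoˡ-≤ e 1≤e) ⟩
  (e ℕ.+ e) ℕ.* q            ≡⟨ solve 2 (λ e q → (e :+ e) :* q := con 2 :* (e :* q)) refl e q ⟩
  2 ℕ.* (e ℕ.* q)            ≤⟨ ℕₚ.*-monoʳ-≤ 2 (2^-cancel-≤ {e ℕ.* q} {p ℕ.* (2 ℕ.* k)} powers) ⟩
  2 ℕ.* (p ℕ.* (2 ℕ.* k))    ≡⟨ solve 2 (λ k p → con 2 :* (p :* (con 2 :* k)) := con 4 :* k :* p) refl k p ⟩
  4 ℕ.* k ℕ.* p              ∎
  where
  d = suc e

  2d≤d² : d ℕ.+ d ≤ d ^ 2
  2d≤d² = begin
    d ℕ.+ d             ≡⟨ solve 1 (λ d → d :+ d := con 2 :* (d :* con 1)) refl d ⟩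
    2 ℕ.* (d ℕ.* 1)     ≤⟨ ℕₚ.*-monoˡ-≤ (d ℕ.* 1) (s≤s 1≤e) ⟩
    d ^ 2               ∎

  powers : 2 ^ (e ℕ.* q) ≤ 2 ^ (p ℕ.* (2 ℕ.* k))
  powers = begin
    2 ^ (e ℕ.* q)              ≡⟨ ℕₚ.^-*-assoc 2 e q ⟨
    (2 ^ e) ^ q                ≤⟨ ℕₚ.^-monoˡ-≤ q (ℕₚ.≤-trans few (ℕₚ.^-monoˡ-≤ k 2d≤d²)) ⟩
    ((d ^ 2) ^ k) ^ q          ≡⟨ cong (_^ q) (ℕₚ.^-*-assoc d 2 k) ⟩
    (d ^ (2 ℕ.* k)) ^ q        ≡⟨ ℕₚ.^-*-assoc d (2 ℕ.* k) q ⟩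
    d ^ (2 ℕ.* k ℕ.* q)        ≡⟨ cong (d ^_) (ℕₚ.*-comm (2 ℕ.* k) q) ⟩
    d ^ (q ℕ.* (2 ℕ.* k))      ≡⟨ ℕₚ.^-*-assoc d q (2 ℕ.* k) ⟨
    (d ^ q) ^ (2 ℕ.* k)        ≤⟨ ℕₚ.^-monoˡ-≤ (2 ℕ.* k) d^q≤2^p ⟩
    (2 ^ p) ^ (2 ℕ.* k)        ≡⟨ ℕₚ.^-*-assoc 2 p (2 ℕ.* k) ⟩
    2 ^ (p ℕ.* (2 ℕ.* k))      ∎

inv-cancelˡ : ∀ c (c>0 : Positive c) q → inv c c>0 * (c * q) ≡ q
inv-cancelˡ c c>0 q = trans (sym (ℚₚ.*-assoc (inv c c>0) c q))
  (trans (cong (_* q) (ℚₚ.*-inverseˡ c {{ℚₚ.pos⇒nonZero c {{c>0}}}})) (ℚₚ.*-identityˡ q))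

inv-cancelʳ : ∀ c (c>0 : Positive c) q → c * (inv c c>0 * q) ≡ q
inv-cancelʳ c c>0 q = trans (sym (ℚₚ.*-assoc c (inv c c>0) q))
  (trans (cong (_* q) (ℚₚ.*-inverseʳ c {{ℚₚ.pos⇒nonZero c {{c>0}}}})) (ℚₚ.*-identityˡ q))

*-inv-cancelʳ : ∀ s (s>0 : Positive s) q → q * s * inv s s>0 ≡ q
*-inv-cancelʳ s s>0 q = trans (ℚₚ.*-assoc q s (inv s s>0))
  (trans (cong (q *_) (ℚₚ.*-inverseʳ s {{ℚₚ.pos⇒nonZero s {{s>0}}}})) (ℚₚ.*-identityʳ q))

pos-mono-< : ∀ c → Positive c → ∀ {p q} → p < q → c * p < c * q
pos-mono-< c c>0 = ℚₚ.*-monoʳ-<-pos c {{c>0}}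

pos-mono-≤ : ∀ c → Positive c → ∀ {p q} → p ℚ.≤ q → c * p ℚ.≤ c * q
pos-mono-≤ c c>0 = ℚₚ.*-monoˡ-≤-nonNeg c {{ℚₚ.pos⇒nonNeg c {{c>0}}}}

inv-pos : ∀ c (c>0 : Positive c) → Positive (inv c c>0)
inv-pos c c>0 = ℚₚ.1/pos⇒pos c {{c>0}}

module _ {c d s : ℚ} (c>0 : Positive c) (d>0 : Positive d) (s>0 : Positive s) where

  private
    c⁻¹ = inv c c>0
    d⁻¹ = inv d d>0
    s⁻¹ = inv s s>0

    s⁻¹-mono : ∀ {p q} → p ℚ.≤ q → p * s⁻¹ ℚ.≤ q * s⁻¹
    s⁻¹-mono {p} {q} le = subst₂ ℚ._≤_ (ℚₚ.*-comm s⁻¹ p) (ℚₚ.*-comm s⁻¹ q) (pos-mono-≤ s⁻¹ (inv-pos s s>0) le)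

  -- The conclusion is `x < c * d / s` in the form in which unfolding `scale` and `recip` presents
  -- it.
  quotient-< : ∀ {x K} → x < K → K * s ℚ.≤ c * d → d⁻¹ * (c⁻¹ * x) < s⁻¹
  quotient-< {x} {K} x<K Ks≤cd = ℚₚ.<-≤-trans
    (pos-mono-< d⁻¹ (inv-pos d d>0) (pos-mono-< c⁻¹ (inv-pos c c>0) x<K))
    (subst₂ ℚ._≤_
      (cong (λ y → d⁻¹ * (c⁻¹ * y)) (*-inv-cancelʳ s s>0 K))
      (trans (cong (λ y → d⁻¹ * (c⁻¹ * y)) (ℚₚ.*-assoc c d s⁻¹))
        (trans (cong (d⁻¹ *_) (inv-cancelˡ c c>0 (d * s⁻¹))) (inv-cancelˡ d d>0 s⁻¹)))
      (pos-mono-≤ d⁻¹ (inv-pos d d>0) (pos-mono-≤ c⁻¹ (inv-pos c c>0) (s⁻¹-mono Ks≤cd))))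

  <-quotient : ∀ {x K} → d⁻¹ * (c⁻¹ * x) < s⁻¹ → d ℚ.≤ K * s → x < c * K
  <-quotient {x} {K} lt d≤Ks = ℚₚ.<-≤-trans
    (subst (_< c * (d * s⁻¹)) (trans (cong (c *_) (inv-cancelʳ d d>0 (c⁻¹ * x))) (inv-cancelʳ c c>0 x))
      (pos-mono-< c c>0 (pos-mono-< d d>0 lt)))
    (pos-mono-≤ c c>0 (subst (d * s⁻¹ ℚ.≤_) (*-inv-cancelʳ s s>0 K) (s⁻¹-mono d≤Ks)))

*-/ : ∀ a b q → toℚᵘ ((+ a / 1) * (+ b / suc q)) ℚᵘ.≃ mkℚᵘ (+ (a ℕ.* b)) q
*-/ a b q = ℚᵘₚ.≃-trans (ℚₚ.toℚᵘ-homo-* (+ a / 1) (+ b / suc q))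
  (ℚᵘₚ.≃-trans (ℚᵘₚ.*-cong (ℚₚ.toℚᵘ-fromℚᵘ (mkℚᵘ (+ a) 0)) (ℚₚ.toℚᵘ-fromℚᵘ (mkℚᵘ (+ b) q)))
    (*≡* (cong₂ ℤ._*_ (sym (ℤₚ.pos-* a b)) (cong +_ (sym (ℕₚ.*-identityˡ (suc q)))))))

/-≤-* : ∀ a b p q → a ℕ.* suc q ≤ b ℕ.* p → + a / 1 ℚ.≤ (+ b / 1) * (+ p / suc q)
/-≤-* a b p q le = ℚₚ.toℚᵘ-cancel-≤
  (ℚᵘₚ.≤-respˡ-≃ (ℚᵘₚ.≃-sym (toℚᵘ-/1 (+ a))) (ℚᵘₚ.≤-respʳ-≃ (ℚᵘₚ.≃-sym (*-/ b p q))
    (*≤* (subst₂ ℤ._≤_ (ℤₚ.pos-* a (suc q)) (sym (ℤₚ.*-identityʳ (+ (b ℕ.* p)))) (ℤ.+≤+ le)))))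

*-/1-mono : ∀ a b c d → a ℕ.* b ≤ c ℕ.* d → (+ a / 1) * (+ b / 1) ℚ.≤ (+ c / 1) * (+ d / 1)
*-/1-mono a b c d le = ℚₚ.toℚᵘ-cancel-≤
  (ℚᵘₚ.≤-respˡ-≃ (ℚᵘₚ.≃-sym (*-/ a b 0)) (ℚᵘₚ.≤-respʳ-≃ (ℚᵘₚ.≃-sym (*-/ c d 0))
    (*≤* (ℤₚ.*-monoʳ-≤-nonNeg (+ 1) (ℤ.+≤+ le)))))

¼*4k≡k : ∀ k → (+ 1 / 4) * (+ (4 ℕ.* k) / 1) ≡ + k / 1
¼*4k≡k k = ℚₚ.toℚᵘ-injective (ℚᵘₚ.≃-trans (ℚₚ.toℚᵘ-homo-* (+ 1 / 4) (+ (4 ℕ.* k) / 1))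
  (ℚᵘₚ.≃-trans (ℚᵘₚ.*-congˡ {ℚᵘ.mkℚᵘ (+ 1) 3} (toℚᵘ-/1 (+ (4 ℕ.* k))))
  (ℚᵘₚ.≃-trans (*≡* (trans (ℤₚ.*-identityʳ _) (trans (ℤₚ.*-identityˡ (+ (4 ℕ.* k)))
                 (trans (ℤₚ.pos-* 4 k) (ℤₚ.*-comm (+ 4) (+ k))))))
    (ℚᵘₚ.≃-sym (toℚᵘ-/1 (+ k))))))

-- A rational in the lower cut comes with some `s` above `log₂ d`, witnessed by a fraction
-- `p / suc q < s`. Then `bound` gives `d ≤ 4 * k * s`, so a quarter of `d / s` is at most `k`.
d/log₂d≤ : ∀ e (2≤d : 2 ≤ suc e) k (c>0 : Positive (+ 1 / 4)) →
           (∀ p q → suc e ^ q ≤ 2 ^ p → suc e ℕ.* q ≤ 4 ℕ.* k ℕ.* p) →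
           scale (+ 1 / 4) c>0 (m/log₂m (suc e) 2≤d) ≤ᴿ fromℕ k
d/log₂d≤ e 2≤d k c>0 bound {x} (s , s>0 , (p , q , p/q<s , d^q≤2^p) , lt) =
  subst (x <_) (¼*4k≡k k) (<-quotient {+ 1 / 4} {+ suc e / 1} {s} c>0 (ℚₚ.normalize-pos (suc e) 1) s>0 {x} {+ (4 ℕ.* k) / 1} lt
    (ℚₚ.≤-trans (/-≤-* (suc e) (4 ℕ.* k) p q (bound p (suc q) d^q≤2^p))
                (ℚₚ.*-monoˡ-≤-nonNeg (+ (4 ℕ.* k) / 1) {{ℚₚ.normalize-nonNeg (4 ℕ.* k) 1}} (ℚₚ.<⇒≤ p/q<s))))

≤d/log₂d : ∀ e (2≤d : 2 ≤ suc e) k n C (c>0 : Positive (+ C / 1)) → suc e ≤ 2 ^ n → k ℕ.* suc n ≤ C ℕ.* suc e →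
           fromℕ k ≤ᴿ scale (+ C / 1) c>0 (m/log₂m (suc e) 2≤d)
≤d/log₂d e 2≤d k n C c>0 d≤2^n kn≤Cd x<k =
  -- The fraction `n / 1` bounds `log₂ d`, but the upper cut asks for a number strictly above it,
  -- hence `suc n`.
  + suc n / 1 , n>0 , (n , 0 , n<n+1 , ℕₚ.≤-trans (ℕₚ.≤-reflexive (ℕₚ.*-identityʳ (suc e))) d≤2^n)
  , quotient-< {+ C / 1} {+ suc e / 1} {+ suc n / 1} c>0 (ℚₚ.normalize-pos (suc e) 1) n>0 {K = + k / 1} x<k
      (*-/1-mono k (suc n) C (suc e) kn≤Cd)
  where
  n>0 : Positive (+ suc n / 1)
  n>0 = ℚₚ.normalize-pos (suc n) 1

  n<n+1 : + n / 1 < + suc n / 1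
  n<n+1 = ℚₚ.≰⇒> λ le → ℕₚ.1+n≰n (ℤₚ.drop‿+≤+ (Equivalence.from (/1-≤ {+ suc n} {+ n}) le))

cubicity-bounds : ∀ d (2≤d : 2 ≤ d) (c₁>0 : Positive (+ 1 / 4)) (c₂>0 : Positive (+ 960 / 1)) →
  ∃[ cub ] IsCubicity (H d) cub
         × scale (+ 1 / 4) c₁>0 (m/log₂m d 2≤d) ≤ᴿ fromℕ cub
         × fromℕ cub ≤ᴿ scale (+ 960 / 1) c₂>0 (m/log₂m d 2≤d)
cubicity-bounds (suc e) 2≤d@(s≤s 1≤e) c₁>0 c₂>0 =
  let m , k , d≤2^ , few , rep = efficient-representation (suc e) 2≤d
      cub , cub≤k , isCub , rep′ = cubicity (H (suc e)) (Adj? (suc e)) rep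
  in cub , isCub
   , (λ {x} → d/log₂d≤ e 2≤d cub c₁>0 (exponent-bound e {cub} 1≤e (rational⇒2^e≤ e rep′)) {x})
   , (λ {x} → ≤d/log₂d e 2≤d cub (3 ℕ.* m) 960 c₂>0 d≤2^ (ℕₚ.≤-trans (ℕₚ.*-monoˡ-≤ (suc (3 ℕ.* m)) cub≤k) few) {x})

theorem3 :
  Σ[ c₁ ∈ ℚ ] Σ[ c₂ ∈ ℚ ] Σ[ c₁>0 ∈ Positive c₁ ] Σ[ c₂>0 ∈ Positive c₂ ]
  Σ[ d₀ ∈ ℕ ] Σ[ 2≤d₀ ∈ 2 ≤ d₀ ]
    (∀ d (d₀≤d : d₀ ≤ d) →
      let d/log₂d = m/log₂m d (≤-trans 2≤d₀ d₀≤d) in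
      ∃[ cub ] IsCubicity (H d) cub
             × scale c₁ c₁>0 d/log₂d ≤ᴿ fromℕ cub
             × fromℕ cub ≤ᴿ scale c₂ c₂>0 d/log₂d)
-- The constants come from `exponent-bound` and `rows-bound`; 2 is where `log₂ d` becomes positive
-- and `2d ≤ d²` starts to hold.
theorem3 = + 1 / 4 , + 960 / 1 , _ , _ , 2 , ℕₚ.≤-refl , λ d 2≤d → cubicity-bounds d (≤-trans ℕₚ.≤-refl 2≤d) _ _
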